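{- Let $m=m_n\ge 1$ and $d=d_n$ be integers with $2\le d\le n$, and let $H^*_{nmd}$ be the random hypergraph on node set $\{1,\dots,n\}$ whose hyperedge set is $\{V_1,\dots,V_m\}$, where $V_1,\dots,V_m$ are mutually independent uniformly random $d$-element subsets of $\{1,\dots,n\}$. Then, as $n\to\infty$, \[ \mathbb{P}(H^*_{nmd} \text{ is connected}) \to \begin{cases} 0 & \text{if } \log n + m\log(1-d/n) \to +\infty,\\ 1 & \text{if } \log n + m\log(1-d/n) \to -\infty.\end{cases} \]
   Context: A hypergraph on node set $V$ is connected if for every partition of $V$ into nonempty sets $V_1',V_2'$ some hyperedge meets both. Convention $\log 0=-\infty$. -}

module Defs where

open import Data.Bool.Properties using () renaming (_≟_ to _≟ᵇ_)
open import Data.Fin.Subset using (Subset; inside; outside; Nonempty; _∪_; _∩_; ⊤; ⊥) renaming (∣_∣ to size)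
open import Data.Fin.Subset.Properties using (nonempty?; anySubset?)
open import Data.Integer.Base using (+_)
open import Data.List.Base using (List; []; _∷_; [_]; _++_; map; filter; length; cartesianProductWith)
open import Data.List.Relation.Unary.Any using (Any; any?)
open import Data.Nat.Base as ℕ using (ℕ; zero; suc; NonZero)
open import Data.Nat.Properties using (_≟_)
open import Data.Product using (_×_; _,_; ∃-syntax)
open import Data.Rational.Base using (ℚ; 0ℚ; 1ℚ; _+_; _*_; _-_; _/_; _≤_; _<_; ∣_∣; +-*-rawSemiring)
open import Data.Vec.Base using (Vec; []; _∷_; toList)
open import Data.Vec.Properties using (≡-dec)
open import Relation.Binary.PropositionalEquality using (_≡_)
open import Relation.Nullary using (Dec; yes; no)
open import Relation.Nullary.Decidable using (¬?; _→-dec_; _×-dec_; decidable-stable)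
open import Relation.Unary using (Pred; Decidable)
open import Level using (0ℓ)

open import Algebra.Definitions.RawSemiring +-*-rawSemiring using (_^_)

fromℕ : ℕ → ℚ
fromℕ k = + k / 1

-- Extended reals as Dedekind cuts: `lower a q` means q < a and `upper a q`
-- means a < q.  −∞ has empty lower set and full upper set.

record Cut : Set₁ where
  field
    lower : Pred ℚ 0ℓ
    upper : Pred ℚ 0ℓ

open Cut public

0ᶜ : Cut
0ᶜ .lower q = q < 0ℚ
0ᶜ .upper q = 0ℚ < q

infixl 6 _+ᶜ_
_+ᶜ_ : Cut → Cut → Cut
(a +ᶜ b) .lower q = ∃[ r ] ∃[ s ] (lower a r × lower b s × q ≡ r + s)
(a +ᶜ b) .upper q = ∃[ r ] ∃[ s ] (upper a r × upper b s × q ≡ r + s)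

infixl 7 _·ᶜ_
_·ᶜ_ : ℕ → Cut → Cut
zero  ·ᶜ a = 0ᶜ
suc m ·ᶜ a = a +ᶜ m ·ᶜ a

-- Comparison of a rational x with the real number e^q.  For every rational q
-- the sequence (1 + q/k)^k, over integers k ≥ 1 with k ≥ |q|, increases to its
-- limit e^q, strictly unless q = 0; so x < e^q iff x < (1 + q/k)^k for some
-- such k.  Applied to −q, this gives e^q < x iff 1 < x (1 − q/k)^k for some
-- such k (x ≥ 0).

_<exp_ : ℚ → ℚ → Set
x <exp q = ∃[ j ] let k = suc j in
  ∣ q ∣ ≤ fromℕ k × x < (1ℚ + q * (+ 1 / k)) ^ k

exp_<_ : ℚ → ℚ → Set
exp q < x = ∃[ j ] let k = suc j in
  ∣ q ∣ ≤ fromℕ k × 1ℚ < x * (1ℚ - q * (+ 1 / k)) ^ k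

-- The natural logarithm of x ≥ 0: q < log x iff e^q < x, and log x < q iff
-- x < e^q.  At x = 0 no q is in the lower set and every q is in the upper set,
-- so log 0 = −∞.

log : ℚ → Cut
log x .lower q = exp q < x
log x .upper q = x <exp q

-- Sequences are indexed by positive integers n, so that d/n makes sense.

Sequence : ∀ {ℓ} → Set ℓ → Set ℓ
Sequence A = ∀ n → .{{NonZero n}} → A

Eventually : Sequence Set → Set
Eventually P = ∃[ N ] (∀ n → .{{_ : NonZero n}} → N ℕ.≤ n → P n)

_⟶_ : Sequence ℚ → ℚ → Set
a ⟶ ℓ = ∀ ε → 0ℚ < ε → Eventually (λ n → ∣ a n - ℓ ∣ < ε)

_⟶+∞ : Sequence Cut → Set
a ⟶+∞ = ∀ K → Eventually (λ n → lower (a n) K)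

_⟶-∞ : Sequence Cut → Set
a ⟶-∞ = ∀ K → Eventually (λ n → upper (a n) K)

-- A hypergraph on the node set Fin n.  Its hyperedge set is the set of members
-- of the list; order and repetitions carry no information.

record Hypergraph (n : ℕ) : Set where
  constructor hypergraph
  field
    hyperedges : List (Subset n)

open Hypergraph public

Meets : ∀ {n} → Subset n → Subset n → Set
Meets e V = Nonempty (e ∩ V)

Partition : ∀ {n} → Subset n → Subset n → Set
Partition V₁ V₂ = Nonempty V₁ × Nonempty V₂ × V₁ ∪ V₂ ≡ ⊤ × V₁ ∩ V₂ ≡ ⊥

Connected : ∀ {n} → Hypergraph n → Set
Connected {n} H = (V₁ V₂ : Subset n) → Partition V₁ V₂ →
  Any (λ e → Meets e V₁ × Meets e V₂) (hyperedges H)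

allSubset? : ∀ {n} {P : Pred (Subset n) 0ℓ} → Decidable P → Dec (∀ V → P V)
allSubset? P? with anySubset? (λ V → ¬? (P? V))
... | yes (V , ¬p) = no (λ f → ¬p (f V))
... | no  ∄¬p      = yes (λ V → decidable-stable (P? V) (λ ¬p → ∄¬p (V , ¬p)))

connected? : ∀ {n} → Decidable (Connected {n})
connected? H = allSubset? λ V₁ → allSubset? λ V₂ →
  (nonempty? V₁ ×-dec nonempty? V₂ ×-dec
   ≡-dec _≟ᵇ_ (V₁ ∪ V₂) ⊤ ×-dec ≡-dec _≟ᵇ_ (V₁ ∩ V₂) ⊥)
  →-dec any? (λ e → nonempty? (e ∩ V₁) ×-dec nonempty? (e ∩ V₂)) (hyperedges H)

subsets : ∀ n → List (Subset n)
subsets zero    = [ [] ]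
subsets (suc n) = map (inside ∷_) (subsets n) ++ map (outside ∷_) (subsets n)

subsetsOfSize : ∀ n → ℕ → List (Subset n)
subsetsOfSize n d = filter (λ V → size V ≟ d) (subsets n)

tuples : ∀ {A : Set} m → List A → List (Vec A m)
tuples zero    xs = [ [] ]
tuples (suc m) xs = cartesianProductWith _∷_ xs (tuples m xs)

-- Probability of the event P under the uniform distribution on a finite sample
-- space listed without repetition; the value for the empty space is junk.

ℙ : ∀ {A : Set} {P : Pred A 0ℓ} → List A → Decidable P → ℚ
ℙ []         P? = 0ℚ
ℙ Ω@(_ ∷ _) P? = + length (filter P? Ω) / length Ω

H* : ∀ {n m} → Vec (Subset n) m → Hypergraph n
H* Vs = hypergraph (toList Vs)

-- The joint law of m independent uniformly random d-subsets is the uniform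
-- distribution on m-tuples of d-subsets.

ℙ-connected : (n m d : ℕ) → ℚ
ℙ-connected n m d =
  ℙ (tuples m (subsetsOfSize n d)) (λ Vs → connected? (H* Vs))

{-# OPTIONS --safe #-}
module Submission where

-- Write x = n (1 − d/n)^m; the logarithmic hypotheses say x → ∞ or x → 0.
--
-- If x → ∞: the number X of isolated nodes has mean x, and two given nodes are
-- isolated with probability at most (1 − d/n)^(2m), so Var X ≤ x and Chebyshev
-- gives ℙ(connected) ≤ ℙ(X = 0) ≤ 1/x.
--
-- If x → 0: let r be the probability that a random d-set does not cross a given
-- split into parts of sizes k ≤ n − k.  Then r ≤ (1 − d/n)^(k(n−k)/(n−1)), by
-- induction on d from the case d = 2, which is Bernoulli's inequality.  With
-- C(n,k) ≤ n^k / k!, k^k ≤ 4^k k! and n^(k−1) ≤ k^(n−1), the expected number of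
-- such splits crossed by no hyperedge is C(n,k) r^m ≤ (4√x)^k when x ≤ 1, and a
-- geometric series bounds ℙ(disconnected).  Fractional exponents are cleared by
-- raising to the power n − 1, after which these estimates, like the bounds on the
-- approximants (1 + q/k)^k of e^q, come from AM-GM with integer weights.

open import Defs
open import Algebra.Bundles using (module CommutativeRing)
open import Data.Fin.Base using (Fin; zero; suc)
import Data.Fin.Properties as Fin
open import Data.Fin.Subset
  using (Subset; inside; outside; Nonempty; _∩_; ⊤; ∁; ⁅_⁆; _∈_; _∉_; _⊆_) renaming (∣_∣ to size)
open import Data.Fin.Subset.Properties
  using (_⊆?_; ⊆⊤; drop-∷-⊆; s⊆s; out⊆; ∣⊤∣≡n; ∣p∣≤n; ∈⊤; ∉⊥; nonempty?; x∈⁅x⁆; x∈⁅y⁆⇒x≡y; x≢y⇒x∉⁅y⁆;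
         ∣⁅x⁆∣≡1; x∉p⇒x∈∁p; x∈p⇒x∉∁p; x∈∁p⇒x∉p; p∪∁p≡⊤; ∣∁p∣≡n∸∣p∣; x∈p∩q⁺; x∈p∩q⁻; x∈p∪q⁻; p∩q⊆p;
         ∩-idem; ∩-comm; ∪-comm; ∩-inverseʳ; p⊆q⇒∣p∣≤∣q∣; p⊂q⇒∣p∣<∣q∣)
open import Data.List.Base
  using (List; []; _∷_; _++_; map; filter; length; cartesianProductWith; applyUpTo; tabulate; allFin)
import Data.List.Membership.Propositional as List
open import Data.List.Membership.Propositional.Properties using (∈-map⁺; ∈-++⁺ˡ; ∈-++⁺ʳ; ∈-filter⁺)
open import Data.List.Properties using (map-++; map-∘; map-tabulate; map-applyUpTo; length-tabulate)
open import Data.List.Relation.Unary.All as All using (All; []; _∷_; all?)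
open import Data.List.Relation.Unary.All.Properties using (all-filter; ¬Any⇒All¬)
open import Data.List.Relation.Unary.Any using (Any; here; there; any?)
open import Data.List.Relation.Unary.Any.Properties using (applyUpTo⁺)
open import Data.Bool.Base using (if_then_else_)
open import Data.Nat.ListAction using (sum)
open import Data.Nat.ListAction.Properties using (sum-++)
open import Data.Nat.Combinatorics using (_C_; nC1≡n; k>n⇒nCk≡0; nCk+nC[k+1]≡[n+1]C[k+1])
open import Data.Nat.Tactic.RingSolver using (solve-∀)
open import Data.Product using (_×_; _,_; ∃-syntax; proj₁; proj₂)
open import Data.Rational.Solver using (module +-*-Solver)
open import Data.Sum using (_⊎_; inj₁; inj₂)
open import Data.Vec.Base using (Vec; []; _∷_; toList; here)
open import Function.Base using (_∘_)
open import Level using (0ℓ)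
open import Relation.Binary.PropositionalEquality
open import Relation.Nullary using (Dec; does; yes; no; contradiction; ¬_)
open import Relation.Nullary.Decidable using (dec-true; dec-false; ¬?; _×-dec_; _⊎-dec_)
open import Relation.Unary using (Pred; Decidable)

-- The exponent k(n-k)/(n-1) comes from d = 2: there r = 1 - 2k(n-k)/(n(n-1)), and the bound 1 -
-- 2t/n ≤ (1 - 2/n)^t has exactly this left side for t = k(n-k)/(n-1). The more natural exponent k
-- would be false: for d = 2 and k = n/2, r tends to 1/2 but (1 - 2/n)^k to 1/e. Since the exponent
-- falls short of k by k(k-1)/(n-1), the power n^k from C(n,k) is not fully absorbed; a factor
-- n^(k(k-1)/(n-1)) is left over. The inequality n^(k-1) ≤ k^(n-1) bounds it by k^k, which the 1/k!
-- in C(n,k) cancels up to 4^k. What remains is 4^k x^(k(n-k)/(n-1)), and n - k ≥ n/2 makes the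
-- exponent of x at least k/2, hence the square root. Probabilities are handled as counts of
-- outcomes, so nearly all estimates are inequalities in ℕ without division. ℚ is needed for the
-- logarithms and for AM-GM, whose intermediate means are fractions.

module RationalInequalities where

  open import Data.Integer.Base as ℤ using (+_)
  import Data.Integer.Properties as ℤ
  open import Data.Nat.Base as ℕ using (ℕ; zero; suc; NonZero)
  import Data.Nat.Properties as ℕ
  open import Data.Rational.Base hiding (NonZero)
  open import Data.Rational.Properties
  import Data.Rational.Unnormalised.Base as ℚᵘ
  import Data.Rational.Unnormalised.Properties as ℚᵘ
  open import Algebra.Definitions.RawSemiring +-*-rawSemiring using (_^_)
  open +-*-Solver using (solve; _:+_; _:*_; _:-_; :-_; con; _:=_)

  -- Embedding of ℕ in ℚ, and AM-GM with integer weights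

  toℚᵘ-fromℕ : ∀ k → toℚᵘ (fromℕ k) ℚᵘ.≃ ℚᵘ.mkℚᵘ (+ k) 0
  toℚᵘ-fromℕ k = toℚᵘ-fromℚᵘ (ℚᵘ.mkℚᵘ (+ k) 0)

  fromℕ-+ : ∀ a b → fromℕ (a ℕ.+ b) ≡ fromℕ a + fromℕ b
  fromℕ-+ a b = toℚᵘ-injective (begin
    toℚᵘ (fromℕ (a ℕ.+ b))                  ≈⟨ toℚᵘ-fromℕ (a ℕ.+ b) ⟩
    ℚᵘ.mkℚᵘ (+ (a ℕ.+ b)) 0                  ≈⟨ ℚᵘ.*≡* (cong (ℤ._* + 1) (cong₂ ℤ._+_ (sym (ℤ.*-identityʳ (+ a))) (sym (ℤ.*-identityʳ (+ b))))) ⟩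
    ℚᵘ.mkℚᵘ (+ a) 0 ℚᵘ.+ ℚᵘ.mkℚᵘ (+ b) 0      ≈⟨ ℚᵘ.+-cong (toℚᵘ-fromℕ a) (toℚᵘ-fromℕ b) ⟨
    toℚᵘ (fromℕ a) ℚᵘ.+ toℚᵘ (fromℕ b)      ≈⟨ toℚᵘ-homo-+ (fromℕ a) (fromℕ b) ⟨
    toℚᵘ (fromℕ a + fromℕ b)               ∎)
    where open ℚᵘ.≃-Reasoning

  fromℕ-* : ∀ a b → fromℕ (a ℕ.* b) ≡ fromℕ a * fromℕ b
  fromℕ-* a b = toℚᵘ-injective (begin
    toℚᵘ (fromℕ (a ℕ.* b))                  ≈⟨ toℚᵘ-fromℕ (a ℕ.* b) ⟩
    ℚᵘ.mkℚᵘ (+ (a ℕ.* b)) 0                  ≈⟨ ℚᵘ.*≡* (cong (ℤ._* + 1) (ℤ.pos-* a b)) ⟩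
    ℚᵘ.mkℚᵘ (+ a) 0 ℚᵘ.* ℚᵘ.mkℚᵘ (+ b) 0      ≈⟨ ℚᵘ.*-cong (toℚᵘ-fromℕ a) (toℚᵘ-fromℕ b) ⟨
    toℚᵘ (fromℕ a) ℚᵘ.* toℚᵘ (fromℕ b)      ≈⟨ toℚᵘ-homo-* (fromℕ a) (fromℕ b) ⟨
    toℚᵘ (fromℕ a * fromℕ b)               ∎)
    where open ℚᵘ.≃-Reasoning

  fromℕ-suc : ∀ a → fromℕ (suc a) ≡ 1ℚ + fromℕ a
  fromℕ-suc a = fromℕ-+ 1 a

  fromℕ-^ : ∀ a k → fromℕ (a ℕ.^ k) ≡ fromℕ a ^ k
  fromℕ-^ a zero    = refl
  fromℕ-^ a (suc k) = trans (fromℕ-* a (a ℕ.^ k)) (cong (fromℕ a *_) (fromℕ-^ a k))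

  fromℕ-mono-≤ : ∀ {a b} → a ℕ.≤ b → fromℕ a ≤ fromℕ b
  fromℕ-mono-≤ {a} {b} a≤b = toℚᵘ-cancel-≤
    (ℚᵘ.≤-trans (ℚᵘ.≤-reflexive (toℚᵘ-fromℕ a))
    (ℚᵘ.≤-trans (ℚᵘ.*≤* (ℤ.*-monoʳ-≤-nonNeg (+ 1) (ℤ.+≤+ a≤b)))
                (ℚᵘ.≤-reflexive (ℚᵘ.≃-sym (toℚᵘ-fromℕ b)))))

  fromℕ-cancel-≤ : ∀ {a b} → fromℕ a ≤ fromℕ b → a ℕ.≤ b
  fromℕ-cancel-≤ {a} {b} p with ℚᵘ.≤-trans (ℚᵘ.≤-reflexive (ℚᵘ.≃-sym (toℚᵘ-fromℕ a)))
    (ℚᵘ.≤-trans (toℚᵘ-mono-≤ p) (ℚᵘ.≤-reflexive (toℚᵘ-fromℕ b)))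
  ... | ℚᵘ.*≤* q = ℤ.drop‿+≤+ (subst₂ ℤ._≤_ (ℤ.*-identityʳ (+ a)) (ℤ.*-identityʳ (+ b)) q)

  0≤fromℕ : ∀ k → 0ℚ ≤ fromℕ k
  0≤fromℕ k = fromℕ-mono-≤ {0} {k} ℕ.z≤n

  fromℕ-pos : ∀ k → .{{NonZero k}} → Positive (fromℕ k)
  fromℕ-pos k = normalize-pos k 1

  [a/k]*k≡a : ∀ a k .{{_ : NonZero k}} → (+ a / k) * fromℕ k ≡ fromℕ a
  [a/k]*k≡a a (suc k) = toℚᵘ-injective (begin
    toℚᵘ ((+ a / suc k) * fromℕ (suc k))                  ≈⟨ toℚᵘ-homo-* (+ a / suc k) (fromℕ (suc k)) ⟩
    toℚᵘ (+ a / suc k) ℚᵘ.* toℚᵘ (fromℕ (suc k))                  ≈⟨ ℚᵘ.*-cong (toℚᵘ-fromℚᵘ (ℚᵘ.mkℚᵘ (+ a) k)) (toℚᵘ-fromℕ (suc k)) ⟩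
    ℚᵘ.mkℚᵘ (+ a) k ℚᵘ.* ℚᵘ.mkℚᵘ (+ suc k) 0                  ≈⟨ ℚᵘ.*≡* (ℤ.*-assoc (+ a) (+ suc k) (+ 1)) ⟩
    ℚᵘ.mkℚᵘ (+ a) 0                  ≈⟨ toℚᵘ-fromℕ a ⟨
    toℚᵘ (fromℕ a)               ∎)
    where open ℚᵘ.≃-Reasoning

  module _ {p q r : ℚ} (0≤r : 0ℚ ≤ r) (p≤q : p ≤ q) where
    *-monoʳ-≤ : p * r ≤ q * r
    *-monoʳ-≤ = *-monoʳ-≤-nonNeg r {{nonNegative 0≤r}} p≤q

    *-monoˡ-≤ : r * p ≤ r * q
    *-monoˡ-≤ = *-monoˡ-≤-nonNeg r {{nonNegative 0≤r}} p≤q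

  0≤* : ∀ {p q} → 0ℚ ≤ p → 0ℚ ≤ q → 0ℚ ≤ p * q
  0≤* {p} {q} 0≤p 0≤q = ≤-trans (≤-reflexive (sym (*-zeroˡ q))) (*-monoʳ-≤ 0≤q 0≤p)

  0≤+ : ∀ {p q} → 0ℚ ≤ p → 0ℚ ≤ q → 0ℚ ≤ p + q
  0≤+ = +-mono-≤

  0≤1ℚ : 0ℚ ≤ 1ℚ
  0≤1ℚ = 0≤fromℕ 1

  0≤^ : ∀ {p} → 0ℚ ≤ p → ∀ k → 0ℚ ≤ p ^ k
  0≤^ 0≤p zero    = 0≤1ℚ
  0≤^ 0≤p (suc k) = 0≤* 0≤p (0≤^ 0≤p k)

  *-mono-≤ : ∀ {p q r s} → 0ℚ ≤ r → 0ℚ ≤ q → p ≤ q → r ≤ s → p * r ≤ q * s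
  *-mono-≤ 0≤r 0≤q p≤q r≤s = ≤-trans (*-monoʳ-≤ 0≤r p≤q) (*-monoˡ-≤ 0≤q r≤s)

  +-cancelʳ-≤ : ∀ r {p q} → p + r ≤ q + r → p ≤ q
  +-cancelʳ-≤ r {p} {q} le = subst₂ _≤_ (undo p) (undo q) (+-monoˡ-≤ (- r) le)
    where
    undo : ∀ x → x + r + - r ≡ x
    undo x = solve 2 (λ x r → x :+ r :- r := x) refl x r

  0≤square : ∀ p → 0ℚ ≤ p * p
  0≤square p with ≤-total 0ℚ p
  ... | inj₁ 0≤p = 0≤* 0≤p 0≤p
  ... | inj₂ p≤0 = ≤-trans (0≤* 0≤-p 0≤-p) (≤-reflexive (solve 1 (λ p → (:- p) :* (:- p) := p :* p) refl p))
    where 0≤-p = neg-antimono-≤ p≤0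

  2pq≤p²+q² : ∀ p q → p * q + p * q ≤ p * p + q * q
  2pq≤p²+q² p q = subst₂ _≤_ (+-identityˡ _)
    (solve 2 (λ p q → (p :- q) :* (p :- q) :+ (p :* q :+ p :* q) := p :* p :+ q :* q) refl p q)
    (+-monoˡ-≤ (p * q + p * q) (0≤square (p - q)))

  -- Bernoulli's inequality for c / a, cleared of denominators.
  bernoulli : ∀ {a c} → 0ℚ ≤ a → 0ℚ ≤ c → ∀ N →
    fromℕ (suc N) * (a ^ N * c) ≤ c ^ suc N + fromℕ N * a ^ suc N
  bernoulli {a} {c} 0≤a 0≤c zero = ≤-reflexive
    (solve 2 (λ a c → con 1ℚ :* (con 1ℚ :* c) := c :* con 1ℚ :+ con 0ℚ :* (a :* con 1ℚ)) refl a c)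
  -- The term added to both sides completes the coefficient N + 2 to 2 (N + 1), so that 2ac ≤ a² +
  -- c² applies.
  bernoulli {a} {c} 0≤a 0≤c (suc N) = +-cancelʳ-≤ (ν * (a * α * c)) (begin
    fromℕ (2 ℕ.+ N) * (a * α * c) + ν * (a * α * c)
      ≡⟨ cong (λ x → x * (a * α * c) + ν * (a * α * c)) (trans (fromℕ-suc (suc N)) (cong (_+_ 1ℚ) (fromℕ-suc N))) ⟩
    (1ℚ + (1ℚ + ν)) * (a * α * c) + ν * (a * α * c)
      ≡⟨ solve 4 (λ ν a α c → (con 1ℚ :+ (con 1ℚ :+ ν)) :* (a :* α :* c) :+ ν :* (a :* α :* c)
                    := (con 1ℚ :+ ν) :* α :* (a :* c :+ a :* c)) refl ν a α c ⟩
    (1ℚ + ν) * α * (a * c + a * c)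
      ≤⟨ *-monoˡ-≤ (0≤* (0≤+ 0≤1ℚ (0≤fromℕ N)) (0≤^ 0≤a N)) (2pq≤p²+q² a c) ⟩
    (1ℚ + ν) * α * (a * a + c * c)
      ≡⟨ solve 4 (λ ν a α c → (con 1ℚ :+ ν) :* α :* (a :* a :+ c :* c)
                    := (con 1ℚ :+ ν) :* (a :* (a :* α)) :+ c :* ((con 1ℚ :+ ν) :* (α :* c))) refl ν a α c ⟩
    (1ℚ + ν) * (a * (a * α)) + c * ((1ℚ + ν) * (α * c))
      ≡⟨ cong (λ x → x * (a * (a * α)) + c * (x * (α * c))) (fromℕ-suc N) ⟨
    fromℕ (suc N) * (a * (a * α)) + c * (fromℕ (suc N) * (α * c))
      ≤⟨ +-monoʳ-≤ (fromℕ (suc N) * (a * (a * α))) (*-monoˡ-≤ 0≤c (bernoulli 0≤a 0≤c N)) ⟩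
    fromℕ (suc N) * (a * (a * α)) + c * (c * γ + ν * (a * α))
      ≡⟨ solve 6 (λ s ν a α c γ → s :* (a :* (a :* α)) :+ c :* (c :* γ :+ ν :* (a :* α))
                    := c :* (c :* γ) :+ s :* (a :* (a :* α)) :+ ν :* (a :* α :* c)) refl (fromℕ (suc N)) ν a α c γ ⟩
    c * (c * γ) + fromℕ (suc N) * (a * (a * α)) + ν * (a * α * c) ∎)
    where
    open ≤-Reasoning
    ν = fromℕ N
    α = a ^ N
    γ = c ^ N

  -- Replacing (N + 1) c by N a + b in `bernoulli` makes the term N a^(N+1) cancel. This is AM-GM
  -- for N equal numbers and one new number.
  am-gm-step : ∀ {a b c} → 0ℚ ≤ a → 0ℚ ≤ c → ∀ N →
    fromℕ (suc N) * c ≡ fromℕ N * a + b → a ^ N * b ≤ c ^ suc N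
  am-gm-step {a} {b} {c} 0≤a 0≤c N mean = +-cancelʳ-≤ (ν * (a * α)) (begin
    α * b + ν * (a * α)   ≡⟨ solve 4 (λ ν a α b → α :* b :+ ν :* (a :* α) := α :* (ν :* a :+ b)) refl ν a α b ⟩
    α * (ν * a + b)       ≡⟨ cong (α *_) mean ⟨
    α * (fromℕ (suc N) * c) ≡⟨ solve 3 (λ s α c → α :* (s :* c) := s :* (α :* c)) refl (fromℕ (suc N)) α c ⟩
    fromℕ (suc N) * (α * c) ≤⟨ bernoulli 0≤a 0≤c N ⟩
    c ^ suc N + ν * (a * α) ∎)
    where
    open ≤-Reasoning
    ν = fromℕ N
    α = a ^ N

  -- The copies of b are appended one at a time: `e` is the mean of the N numbers present so far,
  -- and `am-gm-step` averages N copies of `e` with one more b. At least one copy of a is required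
  -- so that the mean is defined.
  am-gm : ∀ {a b} → 0ℚ ≤ a → 0ℚ ≤ b → ∀ i j {c} → 0ℚ ≤ c →
    fromℕ (suc i ℕ.+ j) * c ≡ fromℕ (suc i) * a + fromℕ j * b →
    a ^ suc i * b ^ j ≤ c ^ (suc i ℕ.+ j)
  am-gm {a} {b} 0≤a 0≤b i zero {c} 0≤c mean rewrite ℕ.+-identityʳ i = ≤-reflexive
    (trans (*-identityʳ (a ^ suc i)) (cong (_^ suc i)
      (*-cancelˡ-fromℕ i (trans (drop-0*b a b (fromℕ (suc i))) (sym mean)))))
    where
    drop-0*b : ∀ a b s → s * a ≡ s * a + 0ℚ * b
    drop-0*b = solve 3 (λ a b s → s :* a := s :* a :+ con 0ℚ :* b) refl
    *-cancelˡ-fromℕ : ∀ i {x y} → fromℕ (suc i) * x ≡ fromℕ (suc i) * y → x ≡ y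
    *-cancelˡ-fromℕ i eq = ≤-antisym
      (*-cancelˡ-≤-pos (fromℕ (suc i)) {{fromℕ-pos (suc i)}} (≤-reflexive eq))
      (*-cancelˡ-≤-pos (fromℕ (suc i)) {{fromℕ-pos (suc i)}} (≤-reflexive (sym eq)))
  am-gm {a} {b} 0≤a 0≤b i (suc j) {c} 0≤c mean rewrite ℕ.+-suc i j = begin
    a ^ suc i * (b * b ^ j)  ≡⟨ solve 3 (λ α b β → α :* (b :* β) := α :* β :* b) refl (a ^ suc i) b (b ^ j) ⟩
    a ^ suc i * b ^ j * b    ≤⟨ *-monoʳ-≤ 0≤b (am-gm 0≤a 0≤b i j 0≤e e-mean) ⟩
    e ^ N * b                ≤⟨ am-gm-step 0≤e 0≤c N c-mean ⟩
    c ^ suc N                ∎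
    where
    open ≤-Reasoning
    N = suc (i ℕ.+ j)
    s = fromℕ (suc i) * a + fromℕ j * b
    e = s * (+ 1 / N)
    0≤e : 0ℚ ≤ e
    0≤e = 0≤* (0≤+ (0≤* (0≤fromℕ (suc i)) 0≤a) (0≤* (0≤fromℕ j) 0≤b))
              (nonNegative⁻¹ (+ 1 / N) {{normalize-nonNeg 1 N}})
    e-mean : fromℕ N * e ≡ s
    e-mean = trans (solve 3 (λ n s r → n :* (s :* r) := s :* (r :* n)) refl (fromℕ N) s (+ 1 / N))
      (trans (cong (s *_) ([a/k]*k≡a 1 N)) (*-identityʳ s))
    c-mean : fromℕ (suc N) * c ≡ fromℕ N * e + b
    c-mean = trans mean (trans (cong (λ x → fromℕ (suc i) * a + x * b) (fromℕ-suc j))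
      (trans (solve 3 (λ u j b → u :+ (con 1ℚ :+ j) :* b := u :+ j :* b :+ b) refl (fromℕ (suc i) * a) (fromℕ j) b)
             (cong (_+ b) (sym e-mean))))

-- From bounds on logarithms to inequalities in ℕ

module Logarithms where

  open import Data.Integer.Base using (+_)
  open import Data.Nat.Base as ℕ using (ℕ; zero; suc; NonZero)
  import Data.Nat.Properties as ℕ
  open import Data.Rational.Base hiding (NonZero)
  open import Data.Rational.Properties
  open import Algebra.Definitions.RawSemiring +-*-rawSemiring using (_^_)
  open +-*-Solver using (solve; _:+_; _:*_; _:-_; :-_; con; _:=_)
  open import Algebra.Properties.CommutativeSemiring.Exp (CommutativeRing.commutativeSemiring +-*-commutativeRing)
    using (^-distrib-*)
  open RationalInequalities

  -- y ≤ x e^q, witnessed by an approximant (1 + q/k)^k ≤ e^q with nonnegative base.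
  record ExpBound (y x q : ℚ) : Set where
    constructor expBound
    field
      k-1    : ℕ
      0≤base : 0ℚ ≤ 1ℚ + q * (+ 1 / suc k-1)
      bound  : y ≤ x * (1ℚ + q * (+ 1 / suc k-1)) ^ suc k-1

  scaled-base : ∀ q k .{{_ : NonZero k}} → fromℕ k * (1ℚ + q * (+ 1 / k)) ≡ fromℕ k + q
  scaled-base q k = begin
    fromℕ k * (1ℚ + q * (+ 1 / k))
      ≡⟨ solve 3 (λ k q r → k :* (con 1ℚ :+ q :* r) := k :+ q :* (r :* k)) refl (fromℕ k) q (+ 1 / k) ⟩
    fromℕ k + q * ((+ 1 / k) * fromℕ k) ≡⟨ cong (λ x → fromℕ k + q * x) ([a/k]*k≡a 1 k) ⟩
    fromℕ k + q * 1ℚ                 ≡⟨ cong (_+_ (fromℕ k)) (*-identityʳ q) ⟩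
    fromℕ k + q                      ∎
    where open ≡-Reasoning

  0≤k+q⇒0≤base : ∀ q k .{{_ : NonZero k}} → 0ℚ ≤ fromℕ k + q → 0ℚ ≤ 1ℚ + q * (+ 1 / k)
  0≤k+q⇒0≤base q k 0≤k+q = *-cancelˡ-≤-pos (fromℕ k) {{fromℕ-pos k}}
    (≤-trans (≤-reflexive (*-zeroʳ (fromℕ k))) (≤-trans 0≤k+q (≤-reflexive (sym (scaled-base q k)))))

  -∣q∣≤q : ∀ q → - ∣ q ∣ ≤ q
  -∣q∣≤q q with ≤-total 0ℚ q
  ... | inj₁ 0≤q rewrite 0≤p⇒∣p∣≡p 0≤q = ≤-trans (neg-antimono-≤ 0≤q) 0≤q
  ... | inj₂ q≤0 rewrite trans (sym (∣-p∣≡∣p∣ q)) (0≤p⇒∣p∣≡p (neg-antimono-≤ q≤0)) =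
    ≤-reflexive (solve 1 (λ q → :- (:- q) := q) refl q)

  ∣q∣≤k⇒0≤k+q : ∀ {q k} → ∣ q ∣ ≤ k → 0ℚ ≤ k + q
  ∣q∣≤k⇒0≤k+q {q} {k} ∣q∣≤k = ≤-trans (≤-reflexive (sym (+-inverseʳ k)))
    (+-monoʳ-≤ k (≤-trans (neg-antimono-≤ ∣q∣≤k) (-∣q∣≤q q)))

  -- The law e^q e^q′ = e^(q+q′) fails for the approximants, but AM-GM gives the inequality in the
  -- needed direction: i + 1 factors 1 + q/(i+1) and j + 1 factors 1 + q′/(j+1) have mean 1 +
  -- (q+q′)/k, where k is their total number.
  expBound-* : ∀ {y y′ x x′ q q′} → 0ℚ ≤ y′ → 0ℚ ≤ x → 0ℚ ≤ x′ →
    ExpBound y x q → ExpBound y′ x′ q′ → ExpBound (y * y′) (x * x′) (q + q′)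
  expBound-* {y} {y′} {x} {x′} {q} {q′} 0≤y′ 0≤x 0≤x′ (expBound i 0≤a y≤) (expBound j 0≤b y′≤) =
    expBound (i ℕ.+ suc j) 0≤c (begin
      y * y′                              ≤⟨ *-mono-≤ 0≤y′ (0≤* 0≤x (0≤^ 0≤a (suc i))) y≤ y′≤ ⟩
      (x * a ^ suc i) * (x′ * b ^ suc j)
        ≡⟨ solve 4 (λ x α x′ β → (x :* α) :* (x′ :* β) := (x :* x′) :* (α :* β)) refl x (a ^ suc i) x′ (b ^ suc j) ⟩
      (x * x′) * (a ^ suc i * b ^ suc j)  ≤⟨ *-monoˡ-≤ (0≤* 0≤x 0≤x′) (am-gm 0≤a 0≤b i (suc j) 0≤c mean) ⟩
      (x * x′) * c ^ k                    ∎)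
    where
    open ≤-Reasoning
    k = suc i ℕ.+ suc j
    a = 1ℚ + q * (+ 1 / suc i)
    b = 1ℚ + q′ * (+ 1 / suc j)
    c = 1ℚ + (q + q′) * (+ 1 / k)
    mean : fromℕ k * c ≡ fromℕ (suc i) * a + fromℕ (suc j) * b
    mean = trans (scaled-base (q + q′) k) (trans (cong (_+ (q + q′)) (fromℕ-+ (suc i) (suc j)))
      (trans (solve 4 (λ i j q q′ → i :+ j :+ (q :+ q′) := i :+ q :+ (j :+ q′)) refl (fromℕ (suc i)) (fromℕ (suc j)) q q′)
        (sym (cong₂ _+_ (scaled-base q (suc i)) (scaled-base q′ (suc j))))))
    0≤c : 0ℚ ≤ c
    0≤c = 0≤k+q⇒0≤base (q + q′) k (≤-trans (0≤+ (0≤* (0≤fromℕ (suc i)) 0≤a) (0≤* (0≤fromℕ (suc j)) 0≤b))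
      (≤-reflexive (trans (sym mean) (scaled-base (q + q′) k))))

  1≤^ : ∀ {p} k → 1ℚ ≤ p → 1ℚ ≤ p ^ k
  1≤^ zero    1≤p = ≤-refl
  1≤^ {p} (suc k) 1≤p = ≤-trans 1≤p (≤-trans (≤-reflexive (sym (*-identityʳ p)))
    (*-monoˡ-≤ (≤-trans 0≤1ℚ 1≤p) (1≤^ k 1≤p)))

  expBound-nonNeg : ∀ {q} → 0ℚ ≤ q → ExpBound 1ℚ 1ℚ q
  expBound-nonNeg {q} 0≤q = expBound 0 (≤-trans 0≤1ℚ 1≤base)
    (≤-trans (1≤^ 1 1≤base) (≤-reflexive (sym (*-identityˡ _))))
    where
    1≤base : 1ℚ ≤ 1ℚ + q * (+ 1 / 1)
    1≤base = ≤-trans (≤-reflexive (sym (+-identityʳ 1ℚ))) (+-monoʳ-≤ 1ℚ (0≤* 0≤q 0≤1ℚ))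

  -- e^(-q) ≤ 1/(1+q): here am-gm averages k copies of 1 - q/k and one of 1 + q, with mean 1.
  expBound-neg : ∀ {y x q} → 0ℚ ≤ x → 0ℚ ≤ q → ExpBound y x (- q) → (1ℚ + q) * y ≤ x
  expBound-neg {y} {x} {q} 0≤x 0≤q (expBound j 0≤a y≤) = begin
    (1ℚ + q) * y             ≤⟨ *-monoˡ-≤ 0≤1+q y≤ ⟩
    (1ℚ + q) * (x * a ^ k)
      ≡⟨ solve 3 (λ q x α → (con 1ℚ :+ q) :* (x :* α) := x :* (α :* ((con 1ℚ :+ q) :* con 1ℚ))) refl q x (a ^ k) ⟩
    x * (a ^ k * (1ℚ + q) ^ 1) ≤⟨ *-monoˡ-≤ 0≤x (am-gm 0≤a 0≤1+q j 1 0≤1ℚ mean) ⟩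
    x * 1ℚ ^ (k ℕ.+ 1)       ≡⟨ cong (x *_) (1^ (k ℕ.+ 1)) ⟩
    x * 1ℚ                   ≡⟨ *-identityʳ x ⟩
    x                        ∎
    where
    open ≤-Reasoning
    k = suc j
    a = 1ℚ + - q * (+ 1 / k)
    0≤1+q = 0≤+ 0≤1ℚ 0≤q
    1^ : ∀ n → 1ℚ ^ n ≡ 1ℚ
    1^ zero    = refl
    1^ (suc n) = trans (*-identityˡ _) (1^ n)
    mean : fromℕ (k ℕ.+ 1) * 1ℚ ≡ fromℕ k * a + 1ℚ * (1ℚ + q)
    mean = trans (cong (_* 1ℚ) (fromℕ-+ k 1))
      (trans (solve 2 (λ k q → (k :+ con 1ℚ) :* con 1ℚ := k :+ (:- q) :+ con 1ℚ :* (con 1ℚ :+ q)) refl (fromℕ k) q)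
             (cong (_+ 1ℚ * (1ℚ + q)) (sym (scaled-base (- q) k))))

  -- The side condition |q| ≤ k in the cut is what makes the base of the approximant nonnegative.
  log-lower⇒expBound : ∀ {x q} → lower (log x) q → ExpBound 1ℚ x (- q)
  log-lower⇒expBound {x} {q} (j , ∣q∣≤k , 1<) =
    expBound j (0≤k+q⇒0≤base (- q) k (∣q∣≤k⇒0≤k+q (subst (_≤ fromℕ k) (sym (∣-p∣≡∣p∣ q)) ∣q∣≤k)))
      (subst (λ z → 1ℚ ≤ x * (1ℚ + z) ^ k) (neg-distribˡ-* q (+ 1 / k)) (<⇒≤ 1<))
    where k = suc j

  log-upper⇒expBound : ∀ {x q} → upper (log x) q → ExpBound x 1ℚ q
  log-upper⇒expBound {x} {q} (j , ∣q∣≤k , x<) =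
    expBound j (0≤k+q⇒0≤base q (suc j) (∣q∣≤k⇒0≤k+q ∣q∣≤k)) (≤-trans (<⇒≤ x<) (≤-reflexive (sym (*-identityˡ _))))

  ·log-lower⇒expBound : ∀ {x} → 0ℚ ≤ x → ∀ m {q} → lower (m ·ᶜ log x) q → ExpBound 1ℚ (x ^ m) (- q)
  ·log-lower⇒expBound 0≤x zero q<0 = expBound-nonNeg (neg-antimono-≤ (<⇒≤ q<0))
  ·log-lower⇒expBound {x} 0≤x (suc m) (r , s , r< , s< , refl) =
    subst (ExpBound 1ℚ (x ^ suc m)) (sym (neg-distrib-+ r s))
      (expBound-* 0≤1ℚ 0≤x (0≤^ 0≤x m) (log-lower⇒expBound {x} r<) (·log-lower⇒expBound 0≤x m s<))

  ·log-upper⇒expBound : ∀ {x} → 0ℚ ≤ x → ∀ m {q} → upper (m ·ᶜ log x) q → ExpBound (x ^ m) 1ℚ q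
  ·log-upper⇒expBound 0≤x zero 0<q = expBound-nonNeg (<⇒≤ 0<q)
  ·log-upper⇒expBound {x} 0≤x (suc m) (r , s , r> , s> , refl) =
    expBound-* (0≤^ 0≤x m) 0≤1ℚ 0≤1ℚ (log-upper⇒expBound {x} r>) (·log-upper⇒expBound 0≤x m s>)

  module _ (n m d K : ℕ) .{{_ : NonZero n}} (d≤n : d ℕ.≤ n) where

    private
      q = 1ℚ - + d / n

      q*n : q * fromℕ n ≡ fromℕ (n ℕ.∸ d)
      q*n = begin
        (1ℚ - + d / n) * fromℕ n
          ≡⟨ solve 2 (λ r n → (con 1ℚ :- r) :* n := n :- r :* n) refl (+ d / n) (fromℕ n) ⟩
        fromℕ n - (+ d / n) * fromℕ n    ≡⟨ cong (λ z → fromℕ n - z) ([a/k]*k≡a d n) ⟩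
        fromℕ n - fromℕ d                ≡⟨ cong (λ z → fromℕ z - fromℕ d) (ℕ.m∸n+n≡m d≤n) ⟨
        fromℕ (n ℕ.∸ d ℕ.+ d) - fromℕ d  ≡⟨ cong (_- fromℕ d) (fromℕ-+ (n ℕ.∸ d) d) ⟩
        fromℕ (n ℕ.∸ d) + fromℕ d - fromℕ d
          ≡⟨ solve 2 (λ e d → e :+ d :- d := e) refl (fromℕ (n ℕ.∸ d)) (fromℕ d) ⟩
        fromℕ (n ℕ.∸ d)                  ∎
        where open ≡-Reasoning

      0≤q : 0ℚ ≤ q
      0≤q = *-cancelʳ-≤-pos (fromℕ n) {{fromℕ-pos n}}
        (subst₂ _≤_ (sym (*-zeroˡ (fromℕ n))) (sym q*n) (0≤fromℕ (n ℕ.∸ d)))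

      q^m*n^m : q ^ m * fromℕ (n ℕ.^ m) ≡ fromℕ ((n ℕ.∸ d) ℕ.^ m)
      q^m*n^m = begin
        q ^ m * fromℕ (n ℕ.^ m)   ≡⟨ cong (q ^ m *_) (fromℕ-^ n m) ⟩
        q ^ m * fromℕ n ^ m       ≡⟨ ^-distrib-* q (fromℕ n) m ⟨
        (q * fromℕ n) ^ m         ≡⟨ cong (_^ m) q*n ⟩
        fromℕ (n ℕ.∸ d) ^ m       ≡⟨ fromℕ-^ (n ℕ.∸ d) m ⟨
        fromℕ ((n ℕ.∸ d) ℕ.^ m)   ∎
        where open ≡-Reasoning

      0≤nq^m : 0ℚ ≤ fromℕ n * q ^ m
      0≤nq^m = 0≤* (0≤fromℕ n) (0≤^ 0≤q m)

      n*q^m*n^m : fromℕ n * q ^ m * fromℕ (n ℕ.^ m) ≡ fromℕ (n ℕ.* (n ℕ.∸ d) ℕ.^ m)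
      n*q^m*n^m = trans (*-assoc (fromℕ n) (q ^ m) (fromℕ (n ℕ.^ m)))
        (trans (cong (fromℕ n *_) q^m*n^m) (sym (fromℕ-* n ((n ℕ.∸ d) ℕ.^ m))))

    -- With x = n (1 - d/n)^m: log x > K gives 1 ≤ x e^(-K) ≤ x / (1 + K), that is K + 1 ≤ x. The
    -- linear bound discards most of e^K but still tends to infinity with K.
    lower⇒large : lower (log (fromℕ n) +ᶜ m ·ᶜ log q) (fromℕ K) →
      suc K ℕ.* n ℕ.^ m ℕ.≤ n ℕ.* (n ℕ.∸ d) ℕ.^ m
    lower⇒large (r , s , r< , s< , K≡) = fromℕ-cancel-≤ (begin
      fromℕ (suc K ℕ.* n ℕ.^ m)          ≡⟨ fromℕ-* (suc K) (n ℕ.^ m) ⟩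
      fromℕ (suc K) * fromℕ (n ℕ.^ m)
        ≡⟨ cong (_* fromℕ (n ℕ.^ m)) (trans (fromℕ-suc K) (sym (*-identityʳ _))) ⟩
      (1ℚ + fromℕ K) * 1ℚ * fromℕ (n ℕ.^ m)
        ≤⟨ *-monoʳ-≤ (0≤fromℕ (n ℕ.^ m)) (expBound-neg 0≤nq^m (0≤fromℕ K) bound) ⟩
      fromℕ n * q ^ m * fromℕ (n ℕ.^ m)  ≡⟨ n*q^m*n^m ⟩
      fromℕ (n ℕ.* (n ℕ.∸ d) ℕ.^ m)      ∎)
      where
      open ≤-Reasoning
      bound : ExpBound 1ℚ (fromℕ n * q ^ m) (- fromℕ K)
      bound = subst (ExpBound 1ℚ (fromℕ n * q ^ m)) (trans (sym (neg-distrib-+ r s)) (cong -_ (sym K≡)))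
        (expBound-* 0≤1ℚ (0≤fromℕ n) (0≤^ 0≤q m) (log-lower⇒expBound {fromℕ n} r<) (·log-lower⇒expBound 0≤q m s<))

    -- The mirror image of `lower⇒large`: x ≤ e^(-K) ≤ 1 / (1 + K).
    upper⇒small : upper (log (fromℕ n) +ᶜ m ·ᶜ log q) (- fromℕ K) →
      suc K ℕ.* (n ℕ.* (n ℕ.∸ d) ℕ.^ m) ℕ.≤ n ℕ.^ m
    upper⇒small (r , s , r> , s> , K≡) = fromℕ-cancel-≤ (begin
      fromℕ (suc K ℕ.* (n ℕ.* (n ℕ.∸ d) ℕ.^ m))          ≡⟨ fromℕ-* (suc K) (n ℕ.* (n ℕ.∸ d) ℕ.^ m) ⟩
      fromℕ (suc K) * fromℕ (n ℕ.* (n ℕ.∸ d) ℕ.^ m)      ≡⟨ cong₂ _*_ (fromℕ-suc K) (sym n*q^m*n^m) ⟩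
      (1ℚ + fromℕ K) * (fromℕ n * q ^ m * fromℕ (n ℕ.^ m))
        ≡⟨ *-assoc (1ℚ + fromℕ K) (fromℕ n * q ^ m) (fromℕ (n ℕ.^ m)) ⟨
      (1ℚ + fromℕ K) * (fromℕ n * q ^ m) * fromℕ (n ℕ.^ m)
        ≤⟨ *-monoʳ-≤ (0≤fromℕ (n ℕ.^ m)) (expBound-neg 0≤1ℚ (0≤fromℕ K) bound) ⟩
      1ℚ * fromℕ (n ℕ.^ m)               ≡⟨ *-identityˡ _ ⟩
      fromℕ (n ℕ.^ m)                    ∎)
      where
      open ≤-Reasoning
      bound : ExpBound (fromℕ n * q ^ m) 1ℚ (- fromℕ K)
      bound = subst (ExpBound (fromℕ n * q ^ m) 1ℚ) (sym K≡)
        (expBound-* (0≤^ 0≤q m) 0≤1ℚ 0≤1ℚ (log-upper⇒expBound {fromℕ n} r>) (·log-upper⇒expBound 0≤q m s>))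

-- Binomial coefficients, factorials and powers

module Binomials where

  import Data.Rational.Base as ℚ
  import Data.Rational.Properties as ℚ
  open import Data.Nat.Base
  open import Data.Nat.Properties
  open RationalInequalities using (am-gm; 0≤fromℕ; fromℕ-+; fromℕ-*; fromℕ-^; fromℕ-cancel-≤)

  am-gm-ℕ : ∀ a b i j c → (suc i + j) * c ≡ suc i * a + j * b →
    a ^ suc i * b ^ j ≤ c ^ (suc i + j)
  am-gm-ℕ a b i j c mean = fromℕ-cancel-≤ (ℚ.≤-trans (ℚ.≤-reflexive eq)
    (ℚ.≤-trans (am-gm (0≤fromℕ a) (0≤fromℕ b) i j (0≤fromℕ c) mean′)
               (ℚ.≤-reflexive (sym (fromℕ-^ c (suc i + j))))))
    where
    eq : fromℕ (a ^ suc i * b ^ j) ≡ _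
    eq = trans (fromℕ-* (a ^ suc i) (b ^ j)) (cong₂ ℚ._*_ (fromℕ-^ a (suc i)) (fromℕ-^ b j))
    mean′ : fromℕ (suc i + j) ℚ.* fromℕ c ≡ fromℕ (suc i) ℚ.* fromℕ a ℚ.+ fromℕ j ℚ.* fromℕ b
    mean′ = trans (sym (fromℕ-* (suc i + j) c)) (trans (cong fromℕ mean)
      (trans (fromℕ-+ (suc i * a) (j * b)) (cong₂ ℚ._+_ (fromℕ-* (suc i) a) (fromℕ-* j b))))

  ^-distribʳ-* : ∀ a b k → (a * b) ^ k ≡ a ^ k * b ^ k
  ^-distribʳ-* a b zero    = refl
  ^-distribʳ-* a b (suc k) = trans (cong (a * b *_) (^-distribʳ-* a b k)) (shuffle a b (a ^ k) (b ^ k))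
    where
    shuffle : ∀ a b x y → a * b * (x * y) ≡ a * x * (b * y)
    shuffle = solve-∀

  ^-comm : ∀ a i j → (a ^ i) ^ j ≡ (a ^ j) ^ i
  ^-comm a i j = trans (^-*-assoc a i j) (trans (cong (a ^_) (*-comm i j)) (sym (^-*-assoc a j i)))

  ^-cancelˡ-≤ : ∀ {a b} k .{{_ : NonZero k}} → a ^ k ≤ b ^ k → a ≤ b
  ^-cancelˡ-≤ {a} {b} k le with a ≤? b
  ... | yes a≤b = a≤b
  ... | no  a≰b = contradiction le (<⇒≱ (^-monoˡ-< k (≰⇒> a≰b)))

  [k+1]*nC[k+1]≡[n∸k]*nCk : ∀ n k → suc k * (n C suc k) ≡ (n ∸ k) * (n C k)
  [k+1]*nC[k+1]≡[n∸k]*nCk zero k = trans (cong (suc k *_) (k>n⇒nCk≡0 {0} {suc k} z<s))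
    (trans (*-zeroʳ (suc k)) (cong (_* (0 C k)) (sym (0∸n≡0 k))))
  [k+1]*nC[k+1]≡[n∸k]*nCk (suc n) zero = trans (*-identityˡ (suc n C 1)) (trans (nC1≡n (suc n)) (sym (*-identityʳ (suc n))))
  [k+1]*nC[k+1]≡[n∸k]*nCk (suc n) (suc k) with suc k ≤? n
  ... | yes k<n = begin
    (2 + k) * (suc n C (2 + k))             ≡⟨ cong ((2 + k) *_) (nCk+nC[k+1]≡[n+1]C[k+1] n (suc k)) ⟨
    (2 + k) * (x + n C (2 + k))             ≡⟨ *-distribˡ-+ (2 + k) x (n C (2 + k)) ⟩
    (2 + k) * x + (2 + k) * (n C (2 + k))   ≡⟨ cong ((2 + k) * x +_) ([k+1]*nC[k+1]≡[n∸k]*nCk n (suc k)) ⟩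
    (2 + k) * x + (n ∸ suc k) * x           ≡⟨ shuffle k x (n ∸ suc k) ⟩
    suc k * x + suc (n ∸ suc k) * x
      ≡⟨ cong₂ (λ u v → u + v * x) ([k+1]*nC[k+1]≡[n∸k]*nCk n k) (sym (+-∸-assoc 1 k<n)) ⟩
    (n ∸ k) * (n C k) + (n ∸ k) * x         ≡⟨ *-distribˡ-+ (n ∸ k) (n C k) x ⟨
    (n ∸ k) * (n C k + x)                   ≡⟨ cong ((n ∸ k) *_) (nCk+nC[k+1]≡[n+1]C[k+1] n k) ⟩
    (n ∸ k) * (suc n C suc k)               ∎
    where
    open ≡-Reasoning
    x = n C suc k
    shuffle : ∀ k x y → (2 + k) * x + y * x ≡ suc k * x + suc y * x
    shuffle = solve-∀
  ... | no k≮n = trans (cong ((2 + k) *_) (k>n⇒nCk≡0 {suc n} {2 + k} (s≤s (≰⇒> k≮n))))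
    (trans (*-zeroʳ (2 + k)) (sym (cong (_* (suc n C suc k)) (m≤n⇒m∸n≡0 {n} {k} (≤-pred (≰⇒> k≮n))))))

  [n+1]*nCk≡[n+1∸k]*[n+1]Ck : ∀ n k → suc n * (n C k) ≡ (suc n ∸ k) * (suc n C k)
  [n+1]*nCk≡[n+1∸k]*[n+1]Ck n k with k ≤? n
  ... | yes k≤n = begin
    suc n * x                        ≡⟨ cong (λ z → suc z * x) (m+[n∸m]≡n k≤n) ⟨
    (suc k + (n ∸ k)) * x            ≡⟨ *-distribʳ-+ x (suc k) (n ∸ k) ⟩
    suc k * x + (n ∸ k) * x          ≡⟨ cong (suc k * x +_) ([k+1]*nC[k+1]≡[n∸k]*nCk n k) ⟨
    suc k * x + suc k * (n C suc k)  ≡⟨ *-distribˡ-+ (suc k) x (n C suc k) ⟨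
    suc k * (x + n C suc k)          ≡⟨ cong (suc k *_) (nCk+nC[k+1]≡[n+1]C[k+1] n k) ⟩
    suc k * (suc n C suc k)          ≡⟨ [k+1]*nC[k+1]≡[n∸k]*nCk (suc n) k ⟩
    (suc n ∸ k) * (suc n C k)        ∎
    where
    open ≡-Reasoning
    x = n C k
  ... | no k≰n = trans (cong (suc n *_) (k>n⇒nCk≡0 (≰⇒> k≰n)))
    (trans (*-zeroʳ (suc n)) (sym (cong (_* (suc n C k)) (m≤n⇒m∸n≡0 {suc n} {k} (≰⇒> k≰n)))))

  -- The quotient C(n-1,k) / C(n,k) = 1 - k/n is the probability that a random k-set misses a given
  -- node.
  n*[n∸1]Ck≡[n∸k]*nCk : ∀ n k → n * ((n ∸ 1) C k) ≡ (n ∸ k) * (n C k)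
  n*[n∸1]Ck≡[n∸k]*nCk zero    k = cong (_* (0 C k)) (sym (0∸n≡0 k))
  n*[n∸1]Ck≡[n∸k]*nCk (suc n) k = [n+1]*nCk≡[n+1∸k]*[n+1]Ck n k

  -- Source of the nonpositive correlation of isolated nodes: missing two given nodes is at most as
  -- likely as two independent misses. It holds because C(n,d) / C(n-1,d) = n / (n-d) decreases in
  -- n.
  nC-log-concave : ∀ {n} d → 2 ≤ n → (n C d) * ((n ∸ 2) C d) ≤ ((n ∸ 1) C d) * ((n ∸ 1) C d)
  nC-log-concave {suc (suc n)} d (s≤s (s≤s z≤n)) with d ≤? n
  ... | no d≰n = ≤-trans (≤-reflexive (trans (cong (((2 + n) C d) *_) (k>n⇒nCk≡0 (≰⇒> d≰n))) (*-zeroʳ ((2 + n) C d)))) z≤n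
  ... | yes d≤n = *-cancelˡ-≤ ((2 + e) * suc n) (begin
    (2 + e) * suc n * (x * z)             ≡⟨ shuffle₁ (2 + e) (suc n) x z ⟩
    (2 + e) * x * (suc n * z)
      ≡⟨ cong₂ (λ u v → u * x * v) (sym (+-∸-assoc 2 d≤n)) ([n+1]*nCk≡[n+1∸k]*[n+1]Ck n d) ⟩
    (2 + n ∸ d) * x * ((suc n ∸ d) * y)
      ≡⟨ cong₂ (λ u v → u * (v * y)) (sym ([n+1]*nCk≡[n+1∸k]*[n+1]Ck (suc n) d)) (+-∸-assoc 1 d≤n) ⟩
    (2 + n) * y * (suc e * y)             ≡⟨ shuffle₂ (2 + n) (suc e) y ⟩
    (2 + n) * suc e * (y * y)             ≤⟨ *-monoˡ-≤ (y * y) coeff ⟩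
    (2 + e) * suc n * (y * y)             ∎)
    where
    open ≤-Reasoning
    e = n ∸ d
    x = (2 + n) C d
    y = suc n C d
    z = n C d
    shuffle₁ : ∀ e n x z → e * n * (x * z) ≡ e * x * (n * z)
    shuffle₁ = solve-∀
    shuffle₂ : ∀ n e y → n * y * (e * y) ≡ n * e * (y * y)
    shuffle₂ = solve-∀
    -- The two products differ by n - e = d.
    coeff : (2 + n) * suc e ≤ (2 + e) * suc n
    coeff = subst₂ _≤_ (l n e) (r n e) (+-monoʳ-≤ (2 + e + n + n * e) (+-monoˡ-≤ 0 (m∸n≤m n d)))
      where
      l : ∀ n e → 2 + e + n + n * e + (e + 0) ≡ (2 + n) * suc e
      l = solve-∀
      r : ∀ n e → 2 + e + n + n * e + (n + 0) ≡ (2 + e) * suc n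
      r = solve-∀

  k!*nCk≤n^k : ∀ n k → k ! * (n C k) ≤ n ^ k
  k!*nCk≤n^k n zero = ≤-refl
  k!*nCk≤n^k n (suc k) = begin
    suc k * k ! * (n C suc k)    ≡⟨ shuffle (suc k) (k !) (n C suc k) ⟩
    k ! * (suc k * (n C suc k))  ≡⟨ cong (k ! *_) ([k+1]*nC[k+1]≡[n∸k]*nCk n k) ⟩
    k ! * ((n ∸ k) * (n C k))    ≡⟨ shuffle′ (k !) (n ∸ k) (n C k) ⟩
    (n ∸ k) * (k ! * (n C k))    ≤⟨ *-mono-≤ (m∸n≤m n k) (k!*nCk≤n^k n k) ⟩
    n * n ^ k                    ∎
    where
    open ≤-Reasoning
    shuffle : ∀ x y z → x * y * z ≡ y * (x * z)
    shuffle = solve-∀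
    shuffle′ : ∀ x y z → x * (y * z) ≡ y * (x * z)
    shuffle′ = solve-∀

  nCk>0 : ∀ n k → k ≤ n → 0 < n C k
  nCk>0 n       zero    _         = z<s
  nCk>0 (suc n) (suc k) (s≤s k≤n) = <-≤-trans (nCk>0 n k k≤n)
    (≤-trans (m≤m+n (n C k) (n C suc k)) (≤-reflexive (nCk+nC[k+1]≡[n+1]C[k+1] n k)))

  -- am-gm for k copies of 1 + 1/k and two copies of 1/2.
  [k+1]^k≤4*k^k : ∀ k → suc k ^ k ≤ 4 * k ^ k
  [k+1]^k≤4*k^k zero = s≤s z≤n
  [k+1]^k≤4*k^k k@(suc i) = *-cancelʳ-≤ (suc k ^ k) (4 * k ^ k) (2 ^ k * (k * k)) {{m*n≢0 (2 ^ k) (k * k) {{m^n≢0 2 k}}}} (begin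
    suc k ^ k * (2 ^ k * (k * k))     ≡⟨ shuffle₁ (suc k ^ k) (2 ^ k) k ⟩
    2 ^ k * suc k ^ k * k ^ 2         ≡⟨ cong (_* k ^ 2) (^-distribʳ-* 2 (suc k) k) ⟨
    (2 * suc k) ^ k * k ^ 2           ≤⟨ am-gm-ℕ (2 * suc k) k i 2 (2 * k) (mean k) ⟩
    (2 * k) ^ (k + 2)                 ≡⟨ ^-distribˡ-+-* (2 * k) k 2 ⟩
    (2 * k) ^ k * (2 * k) ^ 2         ≡⟨ cong (_* (2 * k) ^ 2) (^-distribʳ-* 2 k k) ⟩
    2 ^ k * k ^ k * (2 * k) ^ 2       ≡⟨ shuffle₂ (2 ^ k) (k ^ k) k ⟩
    4 * k ^ k * (2 ^ k * (k * k))     ∎)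
    where
    open ≤-Reasoning
    shuffle₁ : ∀ x y k → x * (y * (k * k)) ≡ y * x * (k * (k * 1))
    shuffle₁ = solve-∀
    shuffle₂ : ∀ x y k → x * y * ((2 * k) * ((2 * k) * 1)) ≡ 4 * y * (x * (k * k))
    shuffle₂ = solve-∀
    mean : ∀ k → (k + 2) * (2 * k) ≡ k * (2 * suc k) + 2 * k
    mean = solve-∀

  -- Passing from k to k + 1 multiplies k^k / k! by (1 + 1/k)^k, which is at most 4.
  k^k≤4^k*k! : ∀ k → k ^ k ≤ 4 ^ k * k !
  k^k≤4^k*k! zero = ≤-refl
  k^k≤4^k*k! (suc k) = begin
    suc k * suc k ^ k            ≤⟨ *-monoʳ-≤ (suc k) ([k+1]^k≤4*k^k k) ⟩
    suc k * (4 * k ^ k)          ≤⟨ *-monoʳ-≤ (suc k) (*-monoʳ-≤ 4 (k^k≤4^k*k! k)) ⟩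
    suc k * (4 * (4 ^ k * k !))  ≡⟨ shuffle (suc k) (4 ^ k) (k !) ⟩
    4 * 4 ^ k * (suc k * k !)    ∎
    where
    open ≤-Reasoning
    shuffle : ∀ x y z → x * (4 * (y * z)) ≡ 4 * y * (x * z)
    shuffle = solve-∀

-- Probability that random d-sets do not cross a given split

module NonCrossingBound where

  open import Data.Nat.Base
  open import Data.Nat.Properties
  open Binomials

  -- Bernoulli's inequality 1 - k/M ≤ (1 - 1/M)^k for k = p + 1 and M = k + e, obtained from AM-GM
  -- for one e and p copies of M, whose mean is M - 1.
  e*[k+e]^k≤[k+e]*[k+e∸1]^k : ∀ p e →
    e * (suc p + e) ^ suc p ≤ (suc p + e) * (p + e) ^ suc p
  e*[k+e]^k≤[k+e]*[k+e∸1]^k p e = begin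
    e * (M * M ^ p)       ≡⟨ shuffle e M (M ^ p) ⟩
    M * (e ^ 1 * M ^ p)   ≤⟨ *-monoʳ-≤ M (am-gm-ℕ e M 0 p (p + e) (mean p e)) ⟩
    M * (p + e) ^ suc p   ∎
    where
    open ≤-Reasoning
    M = suc p + e
    shuffle : ∀ e M y → e * (M * y) ≡ M * (e * 1 * y)
    shuffle = solve-∀
    mean : ∀ p e → suc p * (p + e) ≡ 1 * e + p * (suc p + e)
    mean = solve-∀

  2*nC2≡n*[n∸1] : ∀ n → 2 * (suc n C 2) ≡ suc n * n
  2*nC2≡n*[n∸1] n = trans ([k+1]*nC[k+1]≡[n∸k]*nCk (suc n) 1) (trans (cong (n *_) (nC1≡n (suc n))) (*-comm n (suc n)))

  -- The node set is split into parts of sizes k = p + 1 ≤ l = r + 1, so that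
  -- n − 1 = i and k l is the number of pairs that cross.
  module Split (p r : ℕ) (p≤r : p ≤ r) where

    k l i n s : ℕ
    k = suc p
    l = suc r
    i = suc (p + r)
    n = suc i
    s = k * l

    n≡k+l : n ≡ k + l
    n≡k+l = cong suc (sym (+-suc p r))

    nonCrossing : ℕ → ℕ
    nonCrossing d = l C d + k C d

    -- Each part brings its own factor, l - d or k - d; as k ≤ l the first serves for both, which
    -- lets the induction on d run on the sum of the two counts.
    nonCrossing-suc : ∀ d → suc d * nonCrossing (suc d) ≤ (l ∸ d) * nonCrossing d
    nonCrossing-suc d = begin
      suc d * (l C suc d + k C suc d)                ≡⟨ *-distribˡ-+ (suc d) (l C suc d) (k C suc d) ⟩
      suc d * (l C suc d) + suc d * (k C suc d)
        ≡⟨ cong₂ _+_ ([k+1]*nC[k+1]≡[n∸k]*nCk l d) ([k+1]*nC[k+1]≡[n∸k]*nCk k d) ⟩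
      (l ∸ d) * (l C d) + (k ∸ d) * (k C d)
        ≤⟨ +-monoʳ-≤ ((l ∸ d) * (l C d)) (*-monoˡ-≤ (k C d) (∸-monoˡ-≤ d (s≤s p≤r))) ⟩
      (l ∸ d) * (l C d) + (l ∸ d) * (k C d)          ≡⟨ *-distribˡ-+ (l ∸ d) (l C d) (k C d) ⟨
      (l ∸ d) * nonCrossing d                        ∎
      where open ≤-Reasoning

    -- The l-th power of Bernoulli's inequality (`base`) already supplies all s = k l factors M / (M
    -- + 1); the other p = i - l factors e / (M + 1) are at most 1.
    [l∸d]^i-bound : ∀ d M → n ∸ d ≡ suc M → (l ∸ d) ^ i * suc M ^ s ≤ M ^ s * suc M ^ i
    [l∸d]^i-bound d M eq = begin
      e ^ i * suc M ^ s
        ≡⟨ cong₂ _*_ (trans (cong (e ^_) (sym (+-suc p r))) (^-distribˡ-+-* e p l)) (sym (^-*-assoc (suc M) k l)) ⟩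
      e ^ p * e ^ l * (suc M ^ k) ^ l
        ≡⟨ trans (*-assoc (e ^ p) (e ^ l) _) (cong (e ^ p *_) (sym (^-distribʳ-* e (suc M ^ k) l))) ⟩
      e ^ p * (e * suc M ^ k) ^ l            ≤⟨ *-mono-≤ (^-monoˡ-≤ p e≤M) (^-monoˡ-≤ l base) ⟩
      suc M ^ p * (suc M * M ^ k) ^ l        ≡⟨ cong (suc M ^ p *_) (^-distribʳ-* (suc M) (M ^ k) l) ⟩
      suc M ^ p * (suc M ^ l * (M ^ k) ^ l)  ≡⟨ shuffle (suc M ^ p) (suc M ^ l) ((M ^ k) ^ l) ⟩
      (M ^ k) ^ l * (suc M ^ p * suc M ^ l)
        ≡⟨ cong₂ _*_ (^-*-assoc M k l) (trans (sym (^-distribˡ-+-* (suc M) p l)) (cong (suc M ^_) (+-suc p r))) ⟩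
      M ^ s * suc M ^ i                      ∎
      where
      open ≤-Reasoning
      e = l ∸ d
      e≤M : e ≤ suc M
      e≤M = subst (e ≤_) eq (∸-monoˡ-≤ d (≤-trans (m≤n+m l k) (≤-reflexive (sym n≡k+l))))
      shuffle : ∀ x y z → x * (y * z) ≡ z * (x * y)
      shuffle = solve-∀
      base : e * suc M ^ k ≤ suc M * M ^ k
      base with d ≤? l
      ... | yes d≤l = subst (λ z → e * suc z ^ k ≤ suc z * z ^ k) (suc-injective M≡) (e*[k+e]^k≤[k+e]*[k+e∸1]^k p e)
        where
        M≡ : suc (p + e) ≡ suc M
        M≡ = trans (sym (+-∸-assoc k d≤l)) (trans (cong (_∸ d) (sym n≡k+l)) eq)
      ... | no d≰l = ≤-trans (≤-reflexive (cong (_* suc M ^ k) (m≤n⇒m∸n≡0 (≰⇒≥ d≰l)))) z≤n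

    -- Bernoulli's inequality with the exponent s / i ≥ 1, as AM-GM: i copies of a = 2
    -- `nonCrossing 2` and p r = s - i copies of b = n (n - 1) have mean exactly (n - 1)(n - 2).
    nonCrossing-bound-2 : nonCrossing 2 ^ i * n ^ s ≤ (n ∸ 2) ^ s * (n C 2) ^ i
    nonCrossing-bound-2 = *-cancelʳ-≤ _ _ (2 ^ i * i ^ s) {{m*n≢0 (2 ^ i) (i ^ s) {{m^n≢0 2 i}} {{m^n≢0 i s}}}} (begin
      A ^ i * n ^ s * (2 ^ i * i ^ s)                       ≡⟨ shuffle₁ (A ^ i) (n ^ s) (2 ^ i) (i ^ s) ⟩
      2 ^ i * A ^ i * (n ^ s * i ^ s)
        ≡⟨ cong₂ _*_ (sym (^-distribʳ-* 2 A i)) (sym (^-distribʳ-* n i s)) ⟩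
      (2 * A) ^ i * (n * i) ^ s                             ≡⟨ cong₂ (λ u v → u ^ i * (n * i) ^ v) 2A≡ s≡ ⟩
      a ^ i * b ^ (i + p * r)
        ≡⟨ cong (a ^ i *_) (trans (^-distribˡ-+-* b i (p * r)) (*-comm (b ^ i) (b ^ (p * r)))) ⟩
      a ^ i * (b ^ (p * r) * b ^ i)                         ≡⟨ *-assoc (a ^ i) (b ^ (p * r)) (b ^ i) ⟨
      a ^ i * b ^ (p * r) * b ^ i
        ≤⟨ *-monoˡ-≤ (b ^ i) (am-gm-ℕ a b (p + r) (p * r) (i * (p + r)) (mean p r)) ⟩
      (i * (p + r)) ^ (i + p * r) * b ^ i
        ≡⟨ cong₂ (λ u v → (i * (p + r)) ^ u * v ^ i) (sym s≡) (sym (2*nC2≡n*[n∸1] i)) ⟩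
      (i * (p + r)) ^ s * (2 * (n C 2)) ^ i
        ≡⟨ cong₂ _*_ (^-distribʳ-* i (p + r) s) (^-distribʳ-* 2 (n C 2) i) ⟩
      i ^ s * (p + r) ^ s * (2 ^ i * (n C 2) ^ i)
        ≡⟨ shuffle₂ (i ^ s) ((p + r) ^ s) (2 ^ i) ((n C 2) ^ i) ⟩
      (p + r) ^ s * (n C 2) ^ i * (2 ^ i * i ^ s)           ∎)
      where
      open ≤-Reasoning
      A = nonCrossing 2
      a = suc r * r + suc p * p
      b = n * i
      2A≡ : 2 * A ≡ a
      2A≡ = trans (*-distribˡ-+ 2 (l C 2) (k C 2)) (cong₂ _+_ (2*nC2≡n*[n∸1] r) (2*nC2≡n*[n∸1] p))
      s≡ : s ≡ i + p * r
      s≡ = expand p r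
        where
        expand : ∀ p r → suc p * suc r ≡ suc (p + r) + p * r
        expand = solve-∀
      mean : ∀ p r → (suc (p + r) + p * r) * (suc (p + r) * (p + r)) ≡
        suc (p + r) * (suc r * r + suc p * p) + p * r * (suc (suc (p + r)) * suc (p + r))
      mean = solve-∀
      shuffle₁ : ∀ w x y z → w * x * (y * z) ≡ y * w * (x * z)
      shuffle₁ = solve-∀
      shuffle₂ : ∀ w x y z → w * x * (y * z) ≡ x * z * (y * w)
      shuffle₂ = solve-∀

    -- In terms of r = `nonCrossing d` / C(n,d) this is r^i ≤ (1 - d/n)^s. Going from d to d + 1
    -- multiplies r by at most (l - d)/(n - d) and 1 - d/n by M/(M + 1); `[l∸d]^i-bound` compares
    -- these factors.
    nonCrossing-bound : ∀ d → 2 ≤ d → d ≤ n →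
      nonCrossing d ^ i * n ^ s ≤ (n ∸ d) ^ s * (n C d) ^ i
    nonCrossing-bound 1 (s≤s ()) _
    nonCrossing-bound 2 _ _ = nonCrossing-bound-2
    nonCrossing-bound (suc d@(suc (suc _))) _ d<n = *-cancelʳ-≤ _ _ (suc d ^ i * suc M ^ s)
      {{m*n≢0 (suc d ^ i) (suc M ^ s) {{m^n≢0 (suc d) i}} {{m^n≢0 (suc M) s}}}} (begin
        A′ ^ i * n ^ s * (suc d ^ i * suc M ^ s)
          ≡⟨ shuffle₁ (A′ ^ i) (n ^ s) (suc d ^ i) (suc M ^ s) ⟩
        suc d ^ i * A′ ^ i * (n ^ s * suc M ^ s)
          ≡⟨ cong (_* (n ^ s * suc M ^ s)) (^-distribʳ-* (suc d) A′ i) ⟨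
        (suc d * A′) ^ i * (n ^ s * suc M ^ s)
          ≤⟨ *-monoˡ-≤ (n ^ s * suc M ^ s) (^-monoˡ-≤ i (nonCrossing-suc d)) ⟩
        (e * A) ^ i * (n ^ s * suc M ^ s)
          ≡⟨ cong (_* (n ^ s * suc M ^ s)) (^-distribʳ-* e A i) ⟩
        e ^ i * A ^ i * (n ^ s * suc M ^ s)                 ≡⟨ shuffle₂ (e ^ i) (A ^ i) (n ^ s) (suc M ^ s) ⟩
        e ^ i * suc M ^ s * (A ^ i * n ^ s)
          ≤⟨ *-mono-≤ ([l∸d]^i-bound d M eq) (nonCrossing-bound d (s≤s (s≤s z≤n)) (<⇒≤ d<n)) ⟩
        M ^ s * suc M ^ i * ((n ∸ d) ^ s * (n C d) ^ i)
          ≡⟨ cong (λ z → M ^ s * suc M ^ i * (z ^ s * (n C d) ^ i)) eq ⟩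
        M ^ s * suc M ^ i * (suc M ^ s * (n C d) ^ i)
          ≡⟨ shuffle₃ (M ^ s) (suc M ^ i) (suc M ^ s) ((n C d) ^ i) ⟩
        M ^ s * (suc M ^ i * (n C d) ^ i * suc M ^ s)
          ≡⟨ cong (λ z → M ^ s * (z * suc M ^ s)) (^-distribʳ-* (suc M) (n C d) i) ⟨
        M ^ s * ((suc M * (n C d)) ^ i * suc M ^ s)
          ≡⟨ cong (λ z → M ^ s * (z ^ i * suc M ^ s)) (trans (cong (_* (n C d)) (sym eq)) (sym ([k+1]*nC[k+1]≡[n∸k]*nCk n d))) ⟩
        M ^ s * ((suc d * (n C suc d)) ^ i * suc M ^ s)
          ≡⟨ cong (λ z → M ^ s * (z * suc M ^ s)) (^-distribʳ-* (suc d) (n C suc d) i) ⟩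
        M ^ s * (suc d ^ i * (n C suc d) ^ i * suc M ^ s)
          ≡⟨ shuffle₄ (M ^ s) (suc d ^ i) ((n C suc d) ^ i) (suc M ^ s) ⟩
        M ^ s * (n C suc d) ^ i * (suc d ^ i * suc M ^ s)   ∎)
      where
      open ≤-Reasoning
      M = n ∸ suc d
      e = l ∸ d
      A = nonCrossing d
      A′ = nonCrossing (suc d)
      eq : n ∸ d ≡ suc M
      eq = +-∸-assoc 1 d<n
      shuffle₁ : ∀ w x y z → w * x * (y * z) ≡ y * w * (x * z)
      shuffle₁ = solve-∀
      shuffle₂ : ∀ w x y z → w * x * (y * z) ≡ w * z * (x * y)
      shuffle₂ = solve-∀
      shuffle₃ : ∀ w x y z → w * x * (y * z) ≡ w * (x * z * y)
      shuffle₃ = solve-∀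
      shuffle₄ : ∀ w x y z → w * (x * y * z) ≡ w * y * (x * z)
      shuffle₄ = solve-∀

    -- The numbers 1, taken l times, and n, taken p times, have mean exactly k.
    n^p≤k^i : n ^ p ≤ k ^ i
    n^p≤k^i = begin
      n ^ p              ≡⟨ trans (cong (_* n ^ p) (^-zeroˡ l)) (*-identityˡ (n ^ p)) ⟨
      1 ^ l * n ^ p      ≤⟨ am-gm-ℕ 1 n r p k (mean p r) ⟩
      k ^ (l + p)        ≡⟨ cong (λ z → k ^ suc z) (+-comm r p) ⟩
      k ^ i              ∎
      where
      open ≤-Reasoning
      mean : ∀ p r → (suc r + p) * suc p ≡ suc r * 1 + p * suc (suc (p + r))
      mean = solve-∀

    -- As k i = k p + s, the power n^(k i) from C(n,k)^i exceeds n^s by n^(k p). By `n^p≤k^i` this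
    -- excess is at most k^(k i), which the i-th power of 1/k! absorbs up to (4^k)^i.
    nCk-bound : (n C k) ^ i ≤ (4 ^ k) ^ i * n ^ s
    nCk-bound = *-cancelʳ-≤ _ _ ((n ^ p) ^ k) {{m^n≢0 (n ^ p) k {{m^n≢0 n p}}}} (begin
      (n C k) ^ i * (n ^ p) ^ k        ≤⟨ *-monoʳ-≤ ((n C k) ^ i) (^-monoˡ-≤ k n^p≤k^i) ⟩
      (n C k) ^ i * (k ^ i) ^ k
        ≡⟨ trans (cong ((n C k) ^ i *_) (^-comm k i k)) (sym (^-distribʳ-* (n C k) (k ^ k) i)) ⟩
      ((n C k) * k ^ k) ^ i            ≤⟨ ^-monoˡ-≤ i single ⟩
      (4 ^ k * n ^ k) ^ i              ≡⟨ ^-distribʳ-* (4 ^ k) (n ^ k) i ⟩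
      (4 ^ k) ^ i * (n ^ k) ^ i        ≡⟨ cong ((4 ^ k) ^ i *_) (begin-equality
        (n ^ k) ^ i                      ≡⟨ cong ((n ^ k) ^_) (sym (+-suc p r)) ⟩
        (n ^ k) ^ (p + l)                ≡⟨ ^-distribˡ-+-* (n ^ k) p l ⟩
        (n ^ k) ^ p * (n ^ k) ^ l        ≡⟨ cong₂ _*_ (^-comm n k p) (^-*-assoc n k l) ⟩
        (n ^ p) ^ k * n ^ s              ≡⟨ *-comm ((n ^ p) ^ k) (n ^ s) ⟩
        n ^ s * (n ^ p) ^ k              ∎) ⟩
      (4 ^ k) ^ i * (n ^ s * (n ^ p) ^ k) ≡⟨ *-assoc ((4 ^ k) ^ i) (n ^ s) ((n ^ p) ^ k) ⟨
      (4 ^ k) ^ i * n ^ s * (n ^ p) ^ k ∎)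
      where
      open ≤-Reasoning
      shuffle : ∀ x y z → x * (y * z) ≡ y * (z * x)
      shuffle = solve-∀
      single : (n C k) * k ^ k ≤ 4 ^ k * n ^ k
      single = begin
        (n C k) * k ^ k            ≤⟨ *-monoʳ-≤ (n C k) (k^k≤4^k*k! k) ⟩
        (n C k) * (4 ^ k * k !)    ≡⟨ shuffle (n C k) (4 ^ k) (k !) ⟩
        4 ^ k * (k ! * (n C k))    ≤⟨ *-monoʳ-≤ (4 ^ k) (k!*nCk≤n^k n k) ⟩
        4 ^ k * n ^ k              ∎

    module _ (z : ℕ) where
      -- 1/Z becomes the ratio of the geometric series over k. The square in H compensates for the
      -- exponent s / i of x, which is only guaranteed to be k/2.
      Z H : ℕ
      Z = suc z
      H = 4 * Z * (4 * Z)

      nCk*Z^k-bound : ((n C k) * Z ^ k) ^ i ≤ (H * n) ^ s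
      nCk*Z^k-bound = begin
        ((n C k) * Z ^ k) ^ i               ≡⟨ ^-distribʳ-* (n C k) (Z ^ k) i ⟩
        (n C k) ^ i * (Z ^ k) ^ i           ≤⟨ *-monoˡ-≤ ((Z ^ k) ^ i) nCk-bound ⟩
        (4 ^ k) ^ i * n ^ s * (Z ^ k) ^ i   ≡⟨ shuffle ((4 ^ k) ^ i) (n ^ s) ((Z ^ k) ^ i) ⟩
        (4 ^ k) ^ i * (Z ^ k) ^ i * n ^ s   ≡⟨ cong (_* n ^ s) (^-distribʳ-* (4 ^ k) (Z ^ k) i) ⟨
        (4 ^ k * Z ^ k) ^ i * n ^ s         ≡⟨ cong (λ x → x ^ i * n ^ s) (^-distribʳ-* 4 Z k) ⟨
        ((4 * Z) ^ k) ^ i * n ^ s           ≡⟨ cong (_* n ^ s) (^-*-assoc (4 * Z) k i) ⟩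
        (4 * Z) ^ (k * i) * n ^ s           ≤⟨ *-monoˡ-≤ (n ^ s) (^-monoʳ-≤ (4 * Z) ki≤2s) ⟩
        (4 * Z) ^ (s + s) * n ^ s
          ≡⟨ cong (_* n ^ s) (trans (^-distribˡ-+-* (4 * Z) s s) (sym (^-distribʳ-* (4 * Z) (4 * Z) s))) ⟩
        H ^ s * n ^ s                       ≡⟨ ^-distribʳ-* H n s ⟨
        (H * n) ^ s                         ∎
        where
        open ≤-Reasoning
        shuffle : ∀ x y z → x * y * z ≡ x * z * y
        shuffle = solve-∀
        -- From i = n - 1 ≤ 2 l: the smaller part has at most half of the nodes.
        ki≤2s : k * i ≤ s + s
        ki≤2s = ≤-trans (*-monoʳ-≤ k (≤-trans (s≤s (+-monoˡ-≤ r p≤r)) (≤-trans (n≤1+n _) (≤-reflexive (cong suc (sym (+-suc r r)))))))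
          (≤-reflexive (*-distribˡ-+ k l l))

      nonCrossing^m-bound : ∀ m d → 2 ≤ d → d ≤ n → H * n * (n ∸ d) ^ m ≤ n ^ m →
        (nonCrossing d ^ m) ^ i * (H * n) ^ s ≤ ((n C d) ^ m) ^ i
      nonCrossing^m-bound m d 2≤d d≤n small = *-cancelʳ-≤ _ _ ((n ^ m) ^ s) {{m^n≢0 (n ^ m) s {{m^n≢0 n m}}}} (begin
        (A ^ m) ^ i * (H * n) ^ s * (n ^ m) ^ s
          ≡⟨ cong₂ (λ x y → x * (H * n) ^ s * y) (^-comm A m i) (^-comm n m s) ⟩
        (A ^ i) ^ m * (H * n) ^ s * (n ^ s) ^ m
          ≡⟨ shuffle₁ ((A ^ i) ^ m) ((H * n) ^ s) ((n ^ s) ^ m) ⟩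
        (A ^ i) ^ m * (n ^ s) ^ m * (H * n) ^ s
          ≡⟨ cong (_* (H * n) ^ s) (^-distribʳ-* (A ^ i) (n ^ s) m) ⟨
        (A ^ i * n ^ s) ^ m * (H * n) ^ s
          ≤⟨ *-monoˡ-≤ ((H * n) ^ s) (^-monoˡ-≤ m (nonCrossing-bound d 2≤d d≤n)) ⟩
        ((n ∸ d) ^ s * (n C d) ^ i) ^ m * (H * n) ^ s
          ≡⟨ cong (_* (H * n) ^ s) (^-distribʳ-* ((n ∸ d) ^ s) ((n C d) ^ i) m) ⟩
        ((n ∸ d) ^ s) ^ m * ((n C d) ^ i) ^ m * (H * n) ^ s
          ≡⟨ cong₂ (λ x y → x * y * (H * n) ^ s) (^-comm (n ∸ d) s m) (^-comm (n C d) i m) ⟩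
        ((n ∸ d) ^ m) ^ s * ((n C d) ^ m) ^ i * (H * n) ^ s
          ≡⟨ shuffle₂ (((n ∸ d) ^ m) ^ s) (((n C d) ^ m) ^ i) ((H * n) ^ s) ⟩
        ((n C d) ^ m) ^ i * ((H * n) ^ s * ((n ∸ d) ^ m) ^ s)
          ≡⟨ cong (((n C d) ^ m) ^ i *_) (^-distribʳ-* (H * n) ((n ∸ d) ^ m) s) ⟨
        ((n C d) ^ m) ^ i * (H * n * (n ∸ d) ^ m) ^ s
          ≤⟨ *-monoʳ-≤ (((n C d) ^ m) ^ i) (^-monoˡ-≤ s small) ⟩
        ((n C d) ^ m) ^ i * (n ^ m) ^ s                     ∎)
        where
        open ≤-Reasoning
        A = nonCrossing d
        shuffle₁ : ∀ x y z → x * y * z ≡ x * z * y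
        shuffle₁ = solve-∀
        shuffle₂ : ∀ x y z → x * y * z ≡ y * (z * x)
        shuffle₂ = solve-∀

      -- The hypothesis is H x ≤ 1. The i-th powers of the number of splits and of the probability
      -- of no crossing meet at (H n)^s, so both estimates are joined there and the i-th root is
      -- taken last.
      term-bound : ∀ m d → 2 ≤ d → d ≤ n → H * n * (n ∸ d) ^ m ≤ n ^ m →
        Z ^ k * ((n C k) * nonCrossing d ^ m) ≤ (n C d) ^ m
      term-bound m d 2≤d d≤n small = ^-cancelˡ-≤ i (begin
        (Z ^ k * ((n C k) * A)) ^ i           ≡⟨ cong (_^ i) (shuffle (Z ^ k) (n C k) A) ⟩
        (A * ((n C k) * Z ^ k)) ^ i           ≡⟨ ^-distribʳ-* A ((n C k) * Z ^ k) i ⟩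
        A ^ i * ((n C k) * Z ^ k) ^ i         ≤⟨ *-monoʳ-≤ (A ^ i) nCk*Z^k-bound ⟩
        A ^ i * (H * n) ^ s                   ≤⟨ nonCrossing^m-bound m d 2≤d d≤n small ⟩
        ((n C d) ^ m) ^ i                     ∎)
        where
        open ≤-Reasoning
        A = nonCrossing d ^ m
        shuffle : ∀ x y z → x * (y * z) ≡ z * (y * x)
        shuffle = solve-∀

-- Indicator sums and the size of the sample space

module Counting where

  open import Data.Nat.Base
  open import Data.Nat.Properties

  private variable
    A B : Set
    P Q : Set

  𝟙 : Dec P → ℕ
  𝟙 P? = if does P? then 1 else 0

  𝟙-mono : (P? : Dec P) (Q? : Dec Q) → (P → Q) → 𝟙 P? ≤ 𝟙 Q?
  𝟙-mono (no _)  Q? P→Q = z≤n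
  𝟙-mono (yes p) Q? P→Q rewrite dec-true Q? (P→Q p) = ≤-refl

  𝟙-cong : (P? : Dec P) (Q? : Dec Q) → (P → Q) → (Q → P) → 𝟙 P? ≡ 𝟙 Q?
  𝟙-cong P? Q? P→Q Q→P = ≤-antisym (𝟙-mono P? Q? P→Q) (𝟙-mono Q? P? Q→P)

  𝟙-yes : (P? : Dec P) → P → 𝟙 P? ≡ 1
  𝟙-yes P? p rewrite dec-true P? p = refl

  𝟙-no : (P? : Dec P) → ¬ P → 𝟙 P? ≡ 0
  𝟙-no P? ¬p rewrite dec-false P? ¬p = refl

  𝟙-¬ : (P? : Dec P) → 𝟙 P? + 𝟙 (¬? P?) ≡ 1
  𝟙-¬ (yes _) = refl
  𝟙-¬ (no _)  = refl

  ∑ : List A → (A → ℕ) → ℕ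
  ∑ xs f = sum (map f xs)

  ∑-mono-All : ∀ {f g : A → ℕ} {xs} → All (λ x → f x ≤ g x) xs → ∑ xs f ≤ ∑ xs g
  ∑-mono-All []         = z≤n
  ∑-mono-All (le ∷ les) = +-mono-≤ le (∑-mono-All les)

  ∑-mono : ∀ (xs : List A) {f g : A → ℕ} → (∀ x → f x ≤ g x) → ∑ xs f ≤ ∑ xs g
  ∑-mono xs le = ∑-mono-All (All.universal le xs)

  ∑-cong : ∀ (xs : List A) {f g : A → ℕ} → (∀ x → f x ≡ g x) → ∑ xs f ≡ ∑ xs g
  ∑-cong []       eq = refl
  ∑-cong (x ∷ xs) eq = cong₂ _+_ (eq x) (∑-cong xs eq)

  ∑-const : ∀ (xs : List A) c → ∑ xs (λ _ → c) ≡ length xs * c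
  ∑-const []       c = refl
  ∑-const (x ∷ xs) c = cong (c +_) (∑-const xs c)

  ∑-0 : ∀ (xs : List A) → ∑ xs (λ _ → 0) ≡ 0
  ∑-0 xs = trans (∑-const xs 0) (*-zeroʳ (length xs))

  ∑-+ : ∀ (xs : List A) (f g : A → ℕ) → ∑ xs (λ x → f x + g x) ≡ ∑ xs f + ∑ xs g
  ∑-+ []       f g = refl
  ∑-+ (x ∷ xs) f g = trans (cong (f x + g x +_) (∑-+ xs f g)) (shuffle (f x) (g x) (∑ xs f) (∑ xs g))
    where
    shuffle : ∀ a b c d → a + b + (c + d) ≡ a + c + (b + d)
    shuffle = solve-∀

  ∑-*ˡ : ∀ (xs : List A) c (f : A → ℕ) → ∑ xs (λ x → c * f x) ≡ c * ∑ xs f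
  ∑-*ˡ []       c f = sym (*-zeroʳ c)
  ∑-*ˡ (x ∷ xs) c f = trans (cong (c * f x +_) (∑-*ˡ xs c f)) (sym (*-distribˡ-+ c (f x) (∑ xs f)))

  ∑-*ʳ : ∀ (xs : List A) c (f : A → ℕ) → ∑ xs (λ x → f x * c) ≡ ∑ xs f * c
  ∑-*ʳ xs c f = trans (∑-cong xs (λ x → *-comm (f x) c)) (trans (∑-*ˡ xs c f) (*-comm c (∑ xs f)))

  ∑-swap : ∀ (xs : List A) (ys : List B) (f : A → B → ℕ) →
    ∑ xs (λ x → ∑ ys (f x)) ≡ ∑ ys (λ y → ∑ xs (λ x → f x y))
  ∑-swap []       ys f = sym (∑-0 ys)
  ∑-swap (x ∷ xs) ys f = trans (cong (∑ ys (f x) +_) (∑-swap xs ys f)) (sym (∑-+ ys (f x) _))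

  ∑-++ : ∀ (xs ys : List A) f → ∑ (xs ++ ys) f ≡ ∑ xs f + ∑ ys f
  ∑-++ xs ys f = trans (cong sum (map-++ f xs ys)) (sum-++ (map f xs) (map f ys))

  ∑-map : ∀ (g : A → B) xs f → ∑ (map g xs) f ≡ ∑ xs (f ∘ g)
  ∑-map g xs f = cong sum (sym (map-∘ xs))

  ∑-filter : ∀ {P : Pred A 0ℓ} (P? : Decidable P) xs f → ∑ (filter P? xs) f ≡ ∑ xs (λ x → 𝟙 (P? x) * f x)
  ∑-filter P? []       f = refl
  ∑-filter P? (x ∷ xs) f with P? x
  ... | yes _ = cong₂ _+_ (sym (+-identityʳ (f x))) (∑-filter P? xs f)
  ... | no _  = ∑-filter P? xs f

  length-filter≡∑ : ∀ {P : Pred A 0ℓ} (P? : Decidable P) xs → length (filter P? xs) ≡ ∑ xs (λ x → 𝟙 (P? x))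
  length-filter≡∑ P? xs = trans (sym (*-identityʳ _)) (trans (sym (∑-const (filter P? xs) 1))
    (trans (∑-filter P? xs (λ _ → 1)) (∑-cong xs (λ x → *-identityʳ (𝟙 (P? x))))))

  𝟙≤∑-any : ∀ {P : Set} {Q : Pred A 0ℓ} (P? : Dec P) (Q? : Decidable Q) xs →
    (P → Any Q xs) → 𝟙 P? ≤ ∑ xs (λ x → 𝟙 (Q? x))
  𝟙≤∑-any (no _)  Q? xs P→any = z≤n
  𝟙≤∑-any {Q = Q} (yes p) Q? xs P→any = go (P→any p)
    where
    go : ∀ {xs} → Any Q xs → 1 ≤ ∑ xs (λ x → 𝟙 (Q? x))
    go (here {x} q) rewrite 𝟙-yes (Q? x) q = s≤s z≤n
    go (there {x} qs) = ≤-trans (go qs) (m≤n+m _ (𝟙 (Q? x)))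

  union-bound : ∀ {P : Pred A 0ℓ} {Q : B → Pred A 0ℓ} (P? : Decidable P) (Q? : ∀ y → Decidable (Q y)) Ω ys →
    (∀ ω → P ω → Any (λ y → Q y ω) ys) →
    ∑ Ω (λ ω → 𝟙 (P? ω)) ≤ ∑ ys (λ y → ∑ Ω (λ ω → 𝟙 (Q? y ω)))
  union-bound P? Q? Ω ys cover = ≤-trans
    (∑-mono Ω (λ ω → 𝟙≤∑-any (P? ω) (λ y → Q? y ω) ys (cover ω)))
    (≤-reflexive (∑-swap Ω ys (λ ω y → 𝟙 (Q? y ω))))

  ∑-cartesianProductWith : ∀ {C : Set} (h : A → B → C) xs ys f →
    ∑ (cartesianProductWith h xs ys) f ≡ ∑ xs (λ x → ∑ ys (λ y → f (h x y)))
  ∑-cartesianProductWith h []       ys f = refl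
  ∑-cartesianProductWith h (x ∷ xs) ys f = trans (∑-++ (map (h x) ys) (cartesianProductWith h xs ys) f)
    (cong₂ _+_ (∑-map (h x) ys f) (∑-cartesianProductWith h xs ys f))

  -- Independence of the m hyperedges in counting form: `tuples` is an iterated product and the
  -- indicator factors over the coordinates.
  ∑-tuples-all : ∀ {P : Pred A 0ℓ} (P? : Decidable P) m xs →
    ∑ (tuples m xs) (λ v → 𝟙 (all? P? (toList v))) ≡ ∑ xs (λ x → 𝟙 (P? x)) ^ m
  ∑-tuples-all P? zero    xs = refl
  ∑-tuples-all P? (suc m) xs = begin
    ∑ (tuples (suc m) xs) (λ v → 𝟙 (all? P? (toList v)))
      ≡⟨ ∑-cartesianProductWith _∷_ xs (tuples m xs) _ ⟩
    ∑ xs (λ x → ∑ (tuples m xs) (λ v → 𝟙 (all? P? (x ∷ toList v))))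
      ≡⟨ ∑-cong xs (λ x → trans (∑-cong (tuples m xs) (λ v → head-tail x (toList v))) (∑-*ˡ (tuples m xs) (𝟙 (P? x)) _)) ⟩
    ∑ xs (λ x → 𝟙 (P? x) * ∑ (tuples m xs) (λ v → 𝟙 (all? P? (toList v))))
      ≡⟨ ∑-*ʳ xs _ (λ x → 𝟙 (P? x)) ⟩
    ∑ xs (λ x → 𝟙 (P? x)) * ∑ (tuples m xs) (λ v → 𝟙 (all? P? (toList v)))
      ≡⟨ cong (∑ xs (λ x → 𝟙 (P? x)) *_) (∑-tuples-all P? m xs) ⟩
    ∑ xs (λ x → 𝟙 (P? x)) * ∑ xs (λ x → 𝟙 (P? x)) ^ m ∎
    where
    open ≡-Reasoning
    head-tail : ∀ x ys → 𝟙 (all? P? (x ∷ ys)) ≡ 𝟙 (P? x) * 𝟙 (all? P? ys)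
    head-tail x ys with P? x
    ... | yes _ = sym (*-identityˡ _)
    ... | no _  = refl

  -- The case of `∑-tuples-all` for a predicate that always holds, here 0 ≡ 0.
  length-tuples : ∀ m (xs : List A) → length (tuples m xs) ≡ length xs ^ m
  length-tuples m xs = begin
    length (tuples m xs)               ≡⟨ *-identityʳ _ ⟨
    length (tuples m xs) * 1           ≡⟨ ∑-const (tuples m xs) 1 ⟨
    ∑ (tuples m xs) (λ _ → 1)
      ≡⟨ ∑-cong (tuples m xs) (λ v → 𝟙-yes (all? (λ _ → yes refl) (toList v)) (All.universal (λ _ → refl) (toList v))) ⟨
    ∑ (tuples m xs) (λ v → 𝟙 (all? {P = λ _ → 0 ≡ 0} (λ _ → yes refl) (toList v)))
      ≡⟨ ∑-tuples-all (λ _ → yes refl) m xs ⟩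
    ∑ xs (λ _ → 1) ^ m                 ≡⟨ cong (_^ m) (trans (∑-const xs 1) (*-identityʳ _)) ⟩
    length xs ^ m                      ∎
    where open ≡-Reasoning

  -- Recursion over the nodes: a node outside W excludes every V that contains it, and a node inside
  -- W splits the count by Pascal's rule. All later counts of d-sets are reduced to this one.
  ∑-subsetsOfSize-⊆ : ∀ {n} (W : Subset n) d →
    ∑ (subsetsOfSize n d) (λ V → 𝟙 (V ⊆? W)) ≡ size W C d
  ∑-subsetsOfSize-⊆ {n} W d = trans (∑-filter (λ V → size V ≟ d) (subsets n) _) (count W d)
    where
    open ≡-Reasoning
    term : ∀ {n} → Subset n → ℕ → Subset n → ℕ
    term W d V = 𝟙 (size V ≟ d) * 𝟙 (V ⊆? W)
    split : ∀ {n} (W : Subset (suc n)) d → ∑ (subsets (suc n)) (term W d) ≡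
      ∑ (subsets n) (λ V → term W d (inside ∷ V)) + ∑ (subsets n) (λ V → term W d (outside ∷ V))
    split {n} W d = trans (∑-++ (map (inside ∷_) (subsets n)) _ (term W d))
      (cong₂ _+_ (∑-map (inside ∷_) (subsets n) (term W d)) (∑-map (outside ∷_) (subsets n) (term W d)))
    drop-out : ∀ {n s} (W : Subset n) d V → term (s ∷ W) d (outside ∷ V) ≡ term W d V
    drop-out {s = s} W d V = cong (𝟙 (size V ≟ d) *_) (𝟙-cong (outside ∷ V ⊆? s ∷ W) (V ⊆? W) drop-∷-⊆ out⊆)
    count : ∀ {n} (W : Subset n) d → ∑ (subsets n) (term W d) ≡ size W C d
    count [] zero = cong (λ z → z + 0 + 0) (𝟙-yes ([] ⊆? []) (λ ()))
    count [] (suc d) = sym (k>n⇒nCk≡0 {0} {suc d} z<s)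
    count {suc n} (outside ∷ W) d = begin
      ∑ (subsets (suc n)) (term (outside ∷ W) d) ≡⟨ trans (split (outside ∷ W) d)
        (cong₂ _+_ (trans (∑-cong (subsets n) in⊈out) (∑-0 (subsets n))) (∑-cong (subsets n) (drop-out {s = outside} W d))) ⟩
      ∑ (subsets n) (term W d) ≡⟨ count W d ⟩
      size W C d ∎
      where
      in⊈out : ∀ V → term (outside ∷ W) d (inside ∷ V) ≡ 0
      in⊈out V = trans (cong (𝟙 (suc (size V) ≟ d) *_) (𝟙-no (inside ∷ V ⊆? outside ∷ W) (λ V⊆W → zero∉ (V⊆W here))))
        (*-zeroʳ (𝟙 (suc (size V) ≟ d)))
        where
        zero∉ : ¬ (zero ∈ outside ∷ W)
        zero∉ ()
    count {suc n} (inside ∷ W) zero = begin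
      ∑ (subsets (suc n)) (term (inside ∷ W) 0) ≡⟨ trans (split (inside ∷ W) 0)
        (cong₂ _+_ (∑-0 (subsets n)) (∑-cong (subsets n) (drop-out {s = inside} W 0))) ⟩
      ∑ (subsets n) (term W 0) ≡⟨ count W 0 ⟩
      size W C 0 ∎
    count {suc n} (inside ∷ W) (suc d) = begin
      ∑ (subsets (suc n)) (term (inside ∷ W) (suc d)) ≡⟨ trans (split (inside ∷ W) (suc d))
        (cong₂ _+_ (∑-cong (subsets n) drop-in) (∑-cong (subsets n) (drop-out {s = inside} W (suc d)))) ⟩
      ∑ (subsets n) (term W d) + ∑ (subsets n) (term W (suc d)) ≡⟨ cong₂ _+_ (count W d) (count W (suc d)) ⟩
      size W C d + size W C suc d ≡⟨ nCk+nC[k+1]≡[n+1]C[k+1] (size W) d ⟩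
      suc (size W) C suc d ∎
      where
      drop-in : ∀ V → term (inside ∷ W) (suc d) (inside ∷ V) ≡ term W d V
      drop-in V = cong₂ _*_ (𝟙-cong (suc (size V) ≟ suc d) (size V ≟ d) suc-injective (cong suc))
        (𝟙-cong (inside ∷ V ⊆? inside ∷ W) (V ⊆? W) drop-∷-⊆ s⊆s)

  length-subsetsOfSize : ∀ n d → length (subsetsOfSize n d) ≡ n C d
  length-subsetsOfSize n d = begin
    length (subsetsOfSize n d)                   ≡⟨ *-identityʳ _ ⟨
    length (subsetsOfSize n d) * 1               ≡⟨ ∑-const (subsetsOfSize n d) 1 ⟨
    ∑ (subsetsOfSize n d) (λ _ → 1)              ≡⟨ ∑-cong (subsetsOfSize n d) (λ V → 𝟙-yes (V ⊆? ⊤) ⊆⊤) ⟨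
    ∑ (subsetsOfSize n d) (λ V → 𝟙 (V ⊆? ⊤))     ≡⟨ ∑-subsetsOfSize-⊆ (⊤ {n}) d ⟩
    size (⊤ {n}) C d                             ≡⟨ cong (_C d) (∣⊤∣≡n n) ⟩
    n C d                                        ∎
    where open ≡-Reasoning

  length-sampleSpace : ∀ n m d → length (tuples m (subsetsOfSize n d)) ≡ (n C d) ^ m
  length-sampleSpace n m d = trans (length-tuples m (subsetsOfSize n d)) (cong (_^ m) (length-subsetsOfSize n d))

-- Union bound over separating sets when x → 0

module Disconnected where

  open import Data.Nat.Base
  open import Data.Nat.Properties
  open NonCrossingBound
  open Counting

  ∈-subsets : ∀ {n} (V : Subset n) → V List.∈ subsets n
  ∈-subsets []            = here refl
  ∈-subsets (inside ∷ V)  = ∈-++⁺ˡ (∈-map⁺ (inside ∷_) (∈-subsets V))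
  ∈-subsets (outside ∷ V) = ∈-++⁺ʳ (map (inside ∷_) (subsets _)) (∈-map⁺ (outside ∷_) (∈-subsets V))

  ∈-subsetsOfSize : ∀ {n} (V : Subset n) → V List.∈ subsetsOfSize n (size V)
  ∈-subsetsOfSize V = ∈-filter⁺ (λ U → size U ≟ size V) (∈-subsets V) refl

  NonCrossing : ∀ {n} → Subset n → Subset n → Set
  NonCrossing V e = e ⊆ V ⊎ e ⊆ ∁ V

  nonCrossing? : ∀ {n} (V : Subset n) → Decidable (NonCrossing V)
  nonCrossing? V e = e ⊆? V ⊎-dec e ⊆? ∁ V

  Separates : ∀ {n m} → Subset n → Vec (Subset n) m → Set
  Separates V Vs = All (NonCrossing V) (toList Vs)

  separates? : ∀ {n m} (V : Subset n) → Decidable (Separates {n} {m} V)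
  separates? V Vs = all? (nonCrossing? V) (toList Vs)

  -- Only an inequality, since for d = 0 the empty set lies in both parts.
  ∑-nonCrossing : ∀ {n} (V : Subset n) d →
    ∑ (subsetsOfSize n d) (λ e → 𝟙 (nonCrossing? V e)) ≤ (n ∸ size V) C d + size V C d
  ∑-nonCrossing {n} V d = begin
    ∑ Ω (λ e → 𝟙 (nonCrossing? V e))                        ≤⟨ ∑-mono Ω (λ e → 𝟙-⊎ (e ⊆? V) (e ⊆? ∁ V)) ⟩
    ∑ Ω (λ e → 𝟙 (e ⊆? ∁ V) + 𝟙 (e ⊆? V))                   ≡⟨ ∑-+ Ω _ _ ⟩
    ∑ Ω (λ e → 𝟙 (e ⊆? ∁ V)) + ∑ Ω (λ e → 𝟙 (e ⊆? V))
      ≡⟨ cong₂ _+_ (∑-subsetsOfSize-⊆ (∁ V) d) (∑-subsetsOfSize-⊆ V d) ⟩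
    size (∁ V) C d + size V C d                              ≡⟨ cong (λ k → k C d + size V C d) (∣∁p∣≡n∸∣p∣ V) ⟩
    (n ∸ size V) C d + size V C d                            ∎
    where
    open ≤-Reasoning
    Ω = subsetsOfSize n d
    𝟙-⊎ : ∀ {P Q : Set} (P? : Dec P) (Q? : Dec Q) → 𝟙 (P? ⊎-dec Q?) ≤ 𝟙 Q? + 𝟙 P?
    𝟙-⊎ (yes _) Q?      = m≤n+m 1 (𝟙 Q?)
    𝟙-⊎ (no _)  (yes _) = ≤-refl
    𝟙-⊎ (no _)  (no _)  = ≤-refl

  nonempty⇒size>0 : ∀ {n} {V : Subset n} → Nonempty V → 0 < size V
  nonempty⇒size>0 {V = V} (x , x∈V) = subst (_≤ size V) (∣⁅x⁆∣≡1 x)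
    (p⊆q⇒∣p∣≤∣q∣ (λ y∈ → subst (_∈ V) (sym (x∈⁅y⁆⇒x≡y x y∈)) x∈V))

  partition-swap : ∀ {n} {V₁ V₂ : Subset n} → Partition V₁ V₂ → Partition V₂ V₁
  partition-swap {V₁ = V₁} {V₂} (ne₁ , ne₂ , ∪≡⊤ , ∩≡⊥) =
    ne₂ , ne₁ , trans (∪-comm V₂ V₁) ∪≡⊤ , trans (∩-comm V₂ V₁) ∩≡⊥

  partition-size : ∀ {n} {V₁ V₂ : Subset n} → Partition V₁ V₂ → size V₁ + size V₂ ≤ n
  partition-size {n} {V₁} {V₂} (_ , _ , _ , ∩≡⊥) = begin
    size V₁ + size V₂          ≤⟨ +-monoʳ-≤ (size V₁) (p⊆q⇒∣p∣≤∣q∣ V₂⊆∁V₁) ⟩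
    size V₁ + size (∁ V₁)      ≡⟨ cong (size V₁ +_) (∣∁p∣≡n∸∣p∣ V₁) ⟩
    size V₁ + (n ∸ size V₁)    ≡⟨ m+[n∸m]≡n (∣p∣≤n V₁) ⟩
    n                          ∎
    where
    open ≤-Reasoning
    V₂⊆∁V₁ : V₂ ⊆ ∁ V₁
    V₂⊆∁V₁ {x} x∈V₂ = x∉p⇒x∈∁p (λ x∈V₁ → ∉⊥ (subst (x ∈_) ∩≡⊥ (x∈p∩q⁺ (x∈V₁ , x∈V₂))))

  ¬meets⇒nonCrossing : ∀ {n} {V₁ V₂ e : Subset n} → Partition V₁ V₂ →
    ¬ (Meets e V₁ × Meets e V₂) → NonCrossing V₁ e
  ¬meets⇒nonCrossing {V₁ = V₁} {V₂} {e} (_ , _ , ∪≡⊤ , _) ¬both with nonempty? (e ∩ V₂)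
  ... | no ¬meets = inj₁ λ {x} x∈e → case x x∈e (x∈p∪q⁻ V₁ V₂ (subst (x ∈_) (sym ∪≡⊤) ∈⊤))
    where
    case : ∀ x → x ∈ e → x ∈ V₁ ⊎ x ∈ V₂ → x ∈ V₁
    case x x∈e (inj₁ x∈V₁) = x∈V₁
    case x x∈e (inj₂ x∈V₂) = contradiction (x , x∈p∩q⁺ (x∈e , x∈V₂)) ¬meets
  ... | yes meets = inj₂ λ {x} x∈e → x∉p⇒x∈∁p (λ x∈V₁ → ¬both ((x , x∈p∩q⁺ (x∈e , x∈V₁)) , meets))

  Separable : ∀ {n m} → ℕ → Vec (Subset n) m → Set
  Separable {n} k Vs = Any (λ V → Separates V Vs) (subsetsOfSize n k)

  separable? : ∀ {n m} k → Decidable (Separable {n} {m} k)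
  separable? {n} k Vs = any? (λ V → separates? V Vs) (subsetsOfSize n k)

  -- The possible sizes of the smaller part of a split, 1 to ⌊n/2⌋.
  sizes : ℕ → List ℕ
  sizes n = applyUpTo suc ⌊ n /2⌋

  separates⇒separable : ∀ {n m} (V : Subset n) (Vs : Vec (Subset n) m) → 0 < size V → size V + size V ≤ n →
    Separates V Vs → Any (λ k → Separable k Vs) (sizes n)
  separates⇒separable {n} V Vs 0<k 2k≤n sep with size V in eq
  ... | suc k = applyUpTo⁺ suc separable
      (subst (_≤ ⌊ n /2⌋) (sym (n≡⌊n+n/2⌋ (suc k))) (⌊n/2⌋-mono 2k≤n))
    where
    separable : Separable (suc k) Vs
    separable = List.lose (subst (λ j → V List.∈ subsetsOfSize n j) eq (∈-subsetsOfSize V)) sep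

  -- A proof of `¬ Connected` contains no partition, so the finitely many sizes are searched; if the
  -- search fails, connectedness follows, because the smaller part of an uncrossed partition would
  -- have been found.
  disconnected⇒separable : ∀ {n m} (Vs : Vec (Subset n) m) →
    ¬ Connected (H* Vs) → Any (λ k → Separable k Vs) (sizes n)
  disconnected⇒separable {n} Vs ¬conn with any? (λ k → separable? k Vs) (sizes n)
  ... | yes sep = sep
  ... | no ¬sep = contradiction conn ¬conn
    where
    conn : Connected (H* Vs)
    conn V₁ V₂ part with any? (λ e → nonempty? (e ∩ V₁) ×-dec nonempty? (e ∩ V₂)) (toList Vs)
    ... | yes crossing = crossing
    ... | no ¬crossing with ≤-total (size V₁) (size V₂) | ¬Any⇒All¬ (toList Vs) ¬crossing
    ...   | inj₁ ≤ | none = contradiction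
            (separates⇒separable V₁ Vs (nonempty⇒size>0 (proj₁ part))
              (≤-trans (+-monoʳ-≤ (size V₁) ≤) (partition-size part))
              (All.map (¬meets⇒nonCrossing part) none)) ¬sep
    ...   | inj₂ ≥ | none = contradiction
            (separates⇒separable V₂ Vs (nonempty⇒size>0 (proj₁ (proj₂ part)))
              (≤-trans (+-monoʳ-≤ (size V₂) ≥) (partition-size (partition-swap part)))
              (All.map (λ ¬both → ¬meets⇒nonCrossing (partition-swap part) (λ (a , b) → ¬both (b , a))) none)) ¬sep

  sum-applyUpTo-*ˡ : ∀ c t h → sum (applyUpTo (λ i → c * t i) h) ≡ c * sum (applyUpTo t h)
  sum-applyUpTo-*ˡ c t zero    = sym (*-zeroʳ c)
  sum-applyUpTo-*ˡ c t (suc h) =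
    trans (cong (c * t 0 +_) (sum-applyUpTo-*ˡ c (t ∘ suc) h)) (sym (*-distribˡ-+ c (t 0) _))

  -- The series of Z^(-(i+1)) over i ≥ 0 sums to 1/z, where Z = z + 1. The induction passes to the
  -- sequence Z * t (i + 1), which obeys the same hypothesis with the same T.
  geometric-sum : ∀ z h t T → (∀ i → i < h → suc z ^ suc i * t i ≤ T) → z * sum (applyUpTo t h) ≤ T
  geometric-sum z zero    t T bound = ≤-trans (≤-reflexive (*-zeroʳ z)) z≤n
  geometric-sum z (suc h) t T bound = *-cancelˡ-≤ Z (begin
    Z * (z * (t 0 + S))             ≡⟨ shuffle Z z (t 0) S ⟩
    z * (Z * 1 * t 0) + z * (Z * S)
      ≤⟨ +-mono-≤ (*-monoʳ-≤ z (bound 0 z<s)) (subst (λ x → z * x ≤ T) (sum-applyUpTo-*ˡ Z (t ∘ suc) h) (geometric-sum z h (λ i → Z * t (suc i)) T bound′)) ⟩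
    z * T + T                       ≡⟨ +-comm (z * T) T ⟩
    Z * T                           ∎)
    where
    open ≤-Reasoning
    Z = suc z
    S = sum (applyUpTo (t ∘ suc) h)
    shuffle : ∀ Z z a S → Z * (z * (a + S)) ≡ z * (Z * 1 * a) + z * (Z * S)
    shuffle = solve-∀
    assoc : ∀ x y z → x * (y * z) ≡ y * x * z
    assoc = solve-∀
    bound′ : ∀ i → i < h → Z ^ suc i * (Z * t (suc i)) ≤ T
    bound′ i i<h = ≤-trans (≤-reflexive (assoc (Z ^ suc i) Z (t (suc i)))) (bound (suc i) (s<s i<h))

  -- If H x ≤ 1 with H = (4 (z + 1))², then ℙ(disconnected) ≤ 1/z: one union bound over the sizes k,
  -- one over the sets of size k, and `term-bound` makes the k-th term at most (z + 1)^(-k).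
  disconnected-bound : ∀ z n m d → 2 ≤ d → d ≤ n →
    4 * suc z * (4 * suc z) * n * (n ∸ d) ^ m ≤ n ^ m →
    z * ∑ (tuples m (subsetsOfSize n d)) (λ Vs → 𝟙 (¬? (connected? (H* Vs)))) ≤ (n C d) ^ m
  disconnected-bound z n m d 2≤d d≤n small = ≤-trans (*-monoʳ-≤ z (begin
    ∑ Ω (λ Vs → 𝟙 (¬? (connected? (H* Vs))))
      ≤⟨ union-bound (λ Vs → ¬? (connected? (H* Vs))) separable? Ω (sizes n) disconnected⇒separable ⟩
    ∑ (sizes n) (λ k → ∑ Ω (λ Vs → 𝟙 (separable? k Vs)))
      ≤⟨ ∑-mono (sizes n) (λ k → union-bound (separable? k) separates? Ω (subsetsOfSize n k) (λ _ any → any)) ⟩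
    ∑ (sizes n) (λ k → ∑ (subsetsOfSize n k) (λ V → ∑ Ω (λ Vs → 𝟙 (separates? V Vs))))
      ≤⟨ ∑-mono (sizes n) perSize ⟩
    ∑ (sizes n) (λ k → (n C k) * ((n ∸ k) C d + k C d) ^ m)
      ≡⟨ cong sum (map-applyUpTo suc (λ k → (n C k) * ((n ∸ k) C d + k C d) ^ m) ⌊ n /2⌋) ⟩
    sum (applyUpTo (λ i → (n C suc i) * ((n ∸ suc i) C d + suc i C d) ^ m) ⌊ n /2⌋) ∎))
    (geometric-sum z ⌊ n /2⌋ _ ((n C d) ^ m) term)
    where
    open ≤-Reasoning
    Ω = tuples m (subsetsOfSize n d)
    perSize : ∀ k → ∑ (subsetsOfSize n k) (λ V → ∑ Ω (λ Vs → 𝟙 (separates? V Vs))) ≤ (n C k) * ((n ∸ k) C d + k C d) ^ m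
    perSize k = begin
      ∑ (subsetsOfSize n k) (λ V → ∑ Ω (λ Vs → 𝟙 (separates? V Vs)))
        ≤⟨ ∑-mono-All (All.map perSet (all-filter (λ V → size V ≟ k) (subsets n))) ⟩
      ∑ (subsetsOfSize n k) (λ V → ((n ∸ k) C d + k C d) ^ m)
        ≡⟨ ∑-const (subsetsOfSize n k) _ ⟩
      length (subsetsOfSize n k) * ((n ∸ k) C d + k C d) ^ m
        ≡⟨ cong (_* ((n ∸ k) C d + k C d) ^ m) (length-subsetsOfSize n k) ⟩
      (n C k) * ((n ∸ k) C d + k C d) ^ m ∎
      where
      perSet : ∀ {V} → size V ≡ k → ∑ Ω (λ Vs → 𝟙 (separates? V Vs)) ≤ ((n ∸ k) C d + k C d) ^ m
      perSet {V} refl = ≤-trans (≤-reflexive (∑-tuples-all (nonCrossing? V) m (subsetsOfSize n d)))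
        (^-monoˡ-≤ m (∑-nonCrossing V d))
    term : ∀ i → i < ⌊ n /2⌋ → suc z ^ suc i * ((n C suc i) * ((n ∸ suc i) C d + suc i C d) ^ m) ≤ (n C d) ^ m
    -- `Split` has the number of nodes in the form p + r + 2, so the claim and its hypotheses on n
    -- are transported along n = p + r + 2.
    term p p<h = subst Bound n≡ (λ d≤n small → subst
        (λ l → suc z ^ suc p * ((Split.n p r p≤r C suc p) * (l C d + suc p C d) ^ m) ≤ (Split.n p r p≤r C d) ^ m)
        l≡ (Split.term-bound p r p≤r z m d 2≤d d≤n small)) d≤n small
      where
      Bound : ℕ → Set
      Bound n = d ≤ n → 4 * suc z * (4 * suc z) * n * (n ∸ d) ^ m ≤ n ^ m →
        suc z ^ suc p * ((n C suc p) * ((n ∸ suc p) C d + suc p C d) ^ m) ≤ (n C d) ^ m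
      2k≤n : suc p + suc p ≤ n
      2k≤n = ≤-trans (+-mono-≤ p<h (≤-trans p<h (⌊n/2⌋≤⌈n/2⌉ n))) (≤-reflexive (⌊n/2⌋+⌈n/2⌉≡n n))
      r = n ∸ suc (suc p)
      2+p≤n : suc (suc p) ≤ n
      2+p≤n = ≤-trans (s≤s (subst (suc p ≤_) (sym (+-suc p p)) (s≤s (m≤m+n p p)))) 2k≤n
      n≡ : suc (suc (p + r)) ≡ n
      n≡ = m+[n∸m]≡n 2+p≤n
      p≤r : p ≤ r
      p≤r = m+n≤o⇒n≤o∸m (suc (suc p)) (subst (_≤ n) (cong suc (+-suc p p)) 2k≤n)
        where
        m+n≤o⇒n≤o∸m : ∀ m {n o} → m + n ≤ o → n ≤ o ∸ m
        m+n≤o⇒n≤o∸m m {n} {o} le = m+n≤o⇒m≤o∸n n (subst (_≤ o) (+-comm m n) le)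
      l≡ : suc r ≡ suc (suc (p + r)) ∸ suc p
      l≡ = sym (trans (cong (_∸ p) (sym (+-suc p r))) (m+n∸m≡n p (suc r)))

-- Second moment of the number of isolated nodes when x → ∞

module IsolatedNodes where

  open import Data.Nat.Base
  open import Data.Nat.Properties
  open Binomials
  open Counting

  2xy≤x²+y² : ∀ x y → 2 * (x * y) ≤ x * x + y * y
  2xy≤x²+y² x y with ≤-total x y
  ... | inj₁ x≤y = subst (λ y → 2 * (x * y) ≤ x * x + y * y) (m+[n∸m]≡n x≤y) (ordered x (y ∸ x))
    where
    ordered : ∀ x e → 2 * (x * (x + e)) ≤ x * x + (x + e) * (x + e)
    ordered x e = ≤-trans (m≤m+n (2 * (x * (x + e))) (e * e)) (≤-reflexive (square x e))
      where
      square : ∀ x e → 2 * (x * (x + e)) + e * e ≡ x * x + (x + e) * (x + e)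
      square = solve-∀
  ... | inj₂ y≤x = subst (λ x → 2 * (x * y) ≤ x * x + y * y) (m+[n∸m]≡n y≤x) (ordered y (x ∸ y))
    where
    ordered : ∀ y e → 2 * ((y + e) * y) ≤ (y + e) * (y + e) + y * y
    ordered y e = ≤-trans (m≤m+n (2 * ((y + e) * y)) (e * e)) (≤-reflexive (square y e))
      where
      square : ∀ y e → 2 * ((y + e) * y) + e * e ≡ (y + e) * (y + e) + y * y
      square = solve-∀

  nCk≤[n+1]Ck : ∀ n k → n C k ≤ suc n C k
  nCk≤[n+1]Ck n zero    = ≤-refl
  nCk≤[n+1]Ck n (suc k) = ≤-trans (m≤n+m (n C suc k) (n C k)) (≤-reflexive (nCk+nC[k+1]≡[n+1]C[k+1] n k))

  nCk-monoˡ-≤ : ∀ k {a b} → a ≤ b → a C k ≤ b C k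
  nCk-monoˡ-≤ k {a} a≤b = go (≤⇒≤′ a≤b)
    where
    go : ∀ {b} → a ≤′ b → a C k ≤ b C k
    go ≤′-refl         = ≤-refl
    go (≤′-step {b} p) = ≤-trans (go p) (nCk≤[n+1]Ck b k)

  ∑-allFin-const : ∀ n c → ∑ (allFin n) (λ _ → c) ≡ n * c
  ∑-allFin-const n c = trans (∑-const (allFin n) c) (cong (_* c) (length-tabulate (λ (v : Fin n) → v)))

  ∑-≟ : ∀ {n} (u : Fin n) → ∑ (allFin n) (λ v → 𝟙 (u Fin.≟ v)) ≡ 1
  ∑-≟ u = trans (cong sum (map-tabulate (λ v → v) (λ v → 𝟙 (u Fin.≟ v)))) (go u)
    where
    sum-0 : ∀ n → sum (tabulate {n = n} (λ _ → 0)) ≡ 0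
    sum-0 zero    = refl
    sum-0 (suc n) = sum-0 n
    go : ∀ {n} (u : Fin n) → sum (tabulate (λ v → 𝟙 (u Fin.≟ v))) ≡ 1
    go {suc n} zero = cong suc (sum-0 n)
    go (suc u)      = go u

  -- A node v is isolated iff the hyperedges lie within the complement of ⁅ v ⁆.
  Within : ∀ {n m} → Subset n → Vec (Subset n) m → Set
  Within W Vs = All (_⊆ W) (toList Vs)

  within? : ∀ {n m} (W : Subset n) → Decidable (Within {n} {m} W)
  within? W Vs = all? (_⊆? W) (toList Vs)

  all-⊆-∩ : ∀ {n} {U W : Subset n} {es} → All (_⊆ U) es → All (_⊆ W) es → All (_⊆ U ∩ W) es
  all-⊆-∩ []       []       = []
  all-⊆-∩ (a ∷ as) (b ∷ bs) = (λ x∈e → x∈p∩q⁺ (a x∈e , b x∈e)) ∷ all-⊆-∩ as bs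

  ∑-within : ∀ {n} m d (W : Subset n) →
    ∑ (tuples m (subsetsOfSize n d)) (λ Vs → 𝟙 (within? W Vs)) ≡ (size W C d) ^ m
  ∑-within {n} m d W = trans (∑-tuples-all (_⊆? W) m (subsetsOfSize n d)) (cong (_^ m) (∑-subsetsOfSize-⊆ W d))

  others : ∀ {n} → Fin n → Subset n
  others v = ∁ ⁅ v ⁆

  size-others : ∀ {n} (v : Fin n) → size (others v) ≡ n ∸ 1
  size-others {n} v = trans (∣∁p∣≡n∸∣p∣ ⁅ v ⁆) (cong (n ∸_) (∣⁅x⁆∣≡1 v))

  ∈-others : ∀ {n} {u v : Fin n} → u ≢ v → u ∈ others v
  ∈-others u≢v = x∉p⇒x∈∁p (x≢y⇒x∉⁅y⁆ u≢v)

  v∉others : ∀ {n} (v : Fin n) → v ∉ others v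
  v∉others v = x∈p⇒x∉∁p (x∈⁅x⁆ v)

  size-others-∩ : ∀ {n} {u v : Fin n} → u ≢ v → size (others u ∩ others v) ≤ n ∸ 2
  size-others-∩ {n} {u} {v} u≢v = subst (size (others u ∩ others v) ≤_) (pred[m∸n]≡m∸[1+n] n 1)
    (<⇒≤pred (subst (size (others u ∩ others v) <_) (size-others u) (p⊂q⇒∣p∣<∣q∣
      (p∩q⊆p (others u) (others v) , v , ∈-others (u≢v ∘ sym) ,
       (λ v∈ → v∉others v (proj₂ (x∈p∩q⁻ (others u) (others v) v∈)))))))

  others-nonempty : ∀ {n} → 2 ≤ n → (v : Fin n) → Nonempty (others v)
  others-nonempty (s≤s (s≤s z≤n)) zero    = suc zero , ∈-others {u = suc zero} {zero} (λ ())
  others-nonempty (s≤s (s≤s z≤n)) (suc v) = zero , ∈-others {u = zero} {suc v} (λ ())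

  -- Some hyperedge must cross the split into v and the other nodes, and it contains v. For n ≥ 2
  -- the second part is nonempty.
  connected⇒¬isolated : ∀ {n m} (Vs : Vec (Subset n) m) v → 2 ≤ n → Connected (H* Vs) → ¬ Within (others v) Vs
  connected⇒¬isolated Vs v 2≤n conn within
    with All.lookupAny within (conn ⁅ v ⁆ (others v)
           ((v , x∈⁅x⁆ v) , others-nonempty 2≤n v , p∪∁p≡⊤ ⁅ v ⁆ , ∩-inverseʳ ⁅ v ⁆))
  ... | e⊆others , (x , x∈e∩⁅v⁆) , _ = x∈∁p⇒x∉p (e⊆others (proj₁ x∈)) (proj₂ x∈)
    where x∈ = x∈p∩q⁻ _ ⁅ v ⁆ x∈e∩⁅v⁆

  module SecondMoment (n m d : ℕ) (2≤n : 2 ≤ n) (d≤n : d ≤ n) where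

    -- T counts all outcomes and B₁ those in which a given node is isolated, so M / T is the mean of
    -- X.
    T B₁ M : ℕ
    T  = (n C d) ^ m
    B₁ = ((n ∸ 1) C d) ^ m
    M  = n * B₁

    Ω : List (Vec (Subset n) m)
    Ω = tuples m (subsetsOfSize n d)

    isolated : Vec (Subset n) m → Fin n → ℕ
    isolated Vs v = 𝟙 (within? (others v) Vs)

    X : Vec (Subset n) m → ℕ
    X Vs = ∑ (allFin n) (isolated Vs)

    ∑-X : ∑ Ω X ≡ M
    ∑-X = begin
      ∑ Ω X                                             ≡⟨ ∑-swap Ω (allFin n) isolated ⟩
      ∑ (allFin n) (λ v → ∑ Ω (λ Vs → isolated Vs v))
        ≡⟨ ∑-cong (allFin n) (λ v → trans (∑-within m d (others v)) (cong (λ k → (k C d) ^ m) (size-others v))) ⟩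
      ∑ (allFin n) (λ _ → B₁)                           ≡⟨ ∑-allFin-const n B₁ ⟩
      M                                                 ∎
      where open ≡-Reasoning

    -- Off the diagonal, log-concavity of binomial coefficients gives nonpositive correlation, that
    -- is B₁ * B₁; the diagonal is paid for by T * B₁.
    pair : ∀ (u v : Fin n) → T * (size (others u ∩ others v) C d) ^ m ≤ B₁ * B₁ + 𝟙 (u Fin.≟ v) * (T * B₁)
    pair u v with u Fin.≟ v
    ... | yes refl = begin
      T * (size (others u ∩ others u) C d) ^ m
        ≡⟨ cong (λ k → T * (k C d) ^ m) (trans (cong size (∩-idem (others u))) (size-others u)) ⟩
      T * B₁                                     ≤⟨ m≤n+m (T * B₁) (B₁ * B₁) ⟩
      B₁ * B₁ + T * B₁                           ≡⟨ cong (B₁ * B₁ +_) (*-identityˡ (T * B₁)) ⟨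
      B₁ * B₁ + 1 * (T * B₁)                     ∎
      where open ≤-Reasoning
    ... | no u≢v = begin
      T * (size (others u ∩ others v) C d) ^ m
        ≤⟨ *-monoʳ-≤ T (^-monoˡ-≤ m (nCk-monoˡ-≤ d (size-others-∩ u≢v))) ⟩
      T * ((n ∸ 2) C d) ^ m                           ≡⟨ ^-distribʳ-* (n C d) ((n ∸ 2) C d) m ⟨
      ((n C d) * ((n ∸ 2) C d)) ^ m                   ≤⟨ ^-monoˡ-≤ m (nC-log-concave d 2≤n) ⟩
      (((n ∸ 1) C d) * ((n ∸ 1) C d)) ^ m          ≡⟨ ^-distribʳ-* ((n ∸ 1) C d) ((n ∸ 1) C d) m ⟩
      B₁ * B₁                                    ≡⟨ +-identityʳ (B₁ * B₁) ⟨
      B₁ * B₁ + 0                                ∎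
      where open ≤-Reasoning

    X²≤ : ∀ Vs → X Vs * X Vs ≤ ∑ (allFin n) (λ u → ∑ (allFin n) (λ v → 𝟙 (within? (others u ∩ others v) Vs)))
    X²≤ Vs = begin
      X Vs * X Vs
        ≡⟨ ∑-*ʳ (allFin n) (X Vs) (isolated Vs) ⟨
      ∑ (allFin n) (λ u → isolated Vs u * X Vs)
        ≡⟨ ∑-cong (allFin n) (λ u → ∑-*ˡ (allFin n) (isolated Vs u) (isolated Vs)) ⟨
      ∑ (allFin n) (λ u → ∑ (allFin n) (λ v → isolated Vs u * isolated Vs v))
        ≤⟨ ∑-mono (allFin n) (λ u → ∑-mono (allFin n) (λ v → both (within? (others u) Vs) (within? (others v) Vs)
             (λ wu wv → 𝟙-yes (within? (others u ∩ others v) Vs) (all-⊆-∩ wu wv)))) ⟩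
      ∑ (allFin n) (λ u → ∑ (allFin n) (λ v → 𝟙 (within? (others u ∩ others v) Vs))) ∎
      where
      open ≤-Reasoning
      both : ∀ {P Q : Set} {k} (P? : Dec P) (Q? : Dec Q) → (P → Q → k ≡ 1) → 𝟙 P? * 𝟙 Q? ≤ k
      both (no _)  Q?      f = z≤n
      both (yes _) (no _)  f = z≤n
      both (yes p) (yes q) f = ≤-reflexive (sym (f p q))

    -- Divided by T², the second moment of X is at most μ² + μ with μ = M / T: the n² pairs
    -- contribute μ² and the n diagonal ones μ. Hence Var X ≤ μ.
    T*∑-X² : T * ∑ Ω (λ Vs → X Vs * X Vs) ≤ M * M + T * M
    T*∑-X² = begin
      T * ∑ Ω (λ Vs → X Vs * X Vs)
        ≤⟨ *-monoʳ-≤ T (∑-mono Ω X²≤) ⟩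
      T * ∑ Ω (λ Vs → ∑ (allFin n) (λ u → ∑ (allFin n) (λ v → 𝟙 (within? (others u ∩ others v) Vs))))
        ≡⟨ cong (T *_) (trans (∑-swap Ω (allFin n) _) (∑-cong (allFin n) (λ u → trans (∑-swap Ω (allFin n) _)
             (∑-cong (allFin n) (λ v → ∑-within m d (others u ∩ others v)))))) ⟩
      T * ∑ (allFin n) (λ u → ∑ (allFin n) (λ v → (size (others u ∩ others v) C d) ^ m))
        ≡⟨ trans (sym (∑-*ˡ (allFin n) T _)) (∑-cong (allFin n) (λ u → sym (∑-*ˡ (allFin n) T _))) ⟩
      ∑ (allFin n) (λ u → ∑ (allFin n) (λ v → T * (size (others u ∩ others v) C d) ^ m))
        ≤⟨ ∑-mono (allFin n) (λ u → ∑-mono (allFin n) (pair u)) ⟩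
      ∑ (allFin n) (λ u → ∑ (allFin n) (λ v → B₁ * B₁ + 𝟙 (u Fin.≟ v) * (T * B₁)))
        ≡⟨ ∑-cong (allFin n) row ⟩
      ∑ (allFin n) (λ u → n * (B₁ * B₁) + T * B₁)
        ≡⟨ ∑-allFin-const n (n * (B₁ * B₁) + T * B₁) ⟩
      n * (n * (B₁ * B₁) + T * B₁)
        ≡⟨ collect n B₁ T ⟩
      M * M + T * M ∎
      where
      open ≤-Reasoning
      collect : ∀ n B T → n * (n * (B * B) + T * B) ≡ n * B * (n * B) + T * (n * B)
      collect = solve-∀
      row : ∀ u → ∑ (allFin n) (λ v → B₁ * B₁ + 𝟙 (u Fin.≟ v) * (T * B₁)) ≡ n * (B₁ * B₁) + T * B₁
      row u = trans (∑-+ (allFin n) (λ _ → B₁ * B₁) (λ v → 𝟙 (u Fin.≟ v) * (T * B₁))) (cong₂ _+_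
        (∑-allFin-const n (B₁ * B₁))
        (trans (∑-*ʳ (allFin n) (T * B₁) (λ v → 𝟙 (u Fin.≟ v))) (trans (cong (_* (T * B₁)) (∑-≟ u)) (*-identityˡ (T * B₁)))))

    conn : Vec (Subset n) m → ℕ
    conn Vs = 𝟙 (connected? (H* Vs))

    -- Chebyshev: (X − μ)² ≥ μ² on the event X = 0, scaled by T² with μ = M / T.
    chebyshev : ∀ Vs → M * M * conn Vs + 2 * (M * T) * X Vs ≤ T * T * (X Vs * X Vs) + M * M
    chebyshev Vs with connected? (H* Vs)
    ... | yes c = ≤-reflexive (trans (cong (λ x → M * M * 1 + 2 * (M * T) * x) X≡0)
                    (trans (rearrange (M * M) (2 * (M * T)) (T * T)) (cong (λ x → T * T * (x * x) + M * M) (sym X≡0))))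
      where
      X≡0 : X Vs ≡ 0
      X≡0 = trans (∑-cong (allFin n) (λ v → 𝟙-no (within? (others v) Vs) (connected⇒¬isolated Vs v 2≤n c))) (∑-0 (allFin n))
      rearrange : ∀ a b c → a * 1 + b * 0 ≡ c * (0 * 0) + a
      rearrange = solve-∀
    ... | no _ = subst₂ _≤_ (lhs M T (X Vs)) (rhs M T (X Vs)) (2xy≤x²+y² (T * X Vs) M)
      where
      lhs : ∀ M T X → 2 * (T * X * M) ≡ M * M * 0 + 2 * (M * T) * X
      lhs = solve-∀
      rhs : ∀ M T X → T * X * (T * X) + M * M ≡ T * T * (X * X) + M * M
      rhs = solve-∀

    -- Summing `chebyshev` over Ω gives μ² ℙ(connected) ≤ Var X ≤ μ; the cross term 2 M² T occurs on
    -- both sides and cancels.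
    M*M*∑-conn : M * M * ∑ Ω conn ≤ T * T * M
    M*M*∑-conn = +-cancelʳ-≤ (2 * (M * T) * M) _ _ (begin
      M * M * ∑ Ω conn + 2 * (M * T) * M
        ≡⟨ cong (λ x → M * M * ∑ Ω conn + 2 * (M * T) * x) ∑-X ⟨
      M * M * ∑ Ω conn + 2 * (M * T) * ∑ Ω X
        ≡⟨ cong₂ _+_ (sym (∑-*ˡ Ω (M * M) conn)) (sym (∑-*ˡ Ω (2 * (M * T)) X)) ⟩
      ∑ Ω (λ Vs → M * M * conn Vs) + ∑ Ω (λ Vs → 2 * (M * T) * X Vs) ≡⟨ ∑-+ Ω _ _ ⟨
      ∑ Ω (λ Vs → M * M * conn Vs + 2 * (M * T) * X Vs)             ≤⟨ ∑-mono Ω chebyshev ⟩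
      ∑ Ω (λ Vs → T * T * (X Vs * X Vs) + M * M)                    ≡⟨ ∑-+ Ω _ _ ⟩
      ∑ Ω (λ Vs → T * T * (X Vs * X Vs)) + ∑ Ω (λ _ → M * M)
        ≡⟨ cong₂ _+_ (∑-*ˡ Ω (T * T) _) (trans (∑-const Ω (M * M)) (cong (_* (M * M)) (length-sampleSpace n m d))) ⟩
      T * T * S + T * (M * M)                                       ≡⟨ cong (_+ T * (M * M)) (*-assoc T T S) ⟩
      T * (T * S) + T * (M * M)
        ≤⟨ +-monoˡ-≤ (T * (M * M)) (*-monoʳ-≤ T T*∑-X²) ⟩
      T * (M * M + T * M) + T * (M * M)                             ≡⟨ collect T M ⟩
      T * T * M + 2 * (M * T) * M                                   ∎)
      where
      open ≤-Reasoning
      S = ∑ Ω (λ Vs → X Vs * X Vs)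
      collect : ∀ T M → T * (M * M + T * M) + T * (M * M) ≡ T * T * M + 2 * (M * T) * M
      collect = solve-∀

    -- A given node is isolated with probability B₁ / T = (1 - d/n)^m, so the mean M / T is x.
    n^m*B₁ : n ^ m * B₁ ≡ (n ∸ d) ^ m * T
    n^m*B₁ = trans (sym (^-distribʳ-* n ((n ∸ 1) C d) m)) (trans (cong (_^ m) (n*[n∸1]Ck≡[n∸k]*nCk n d)) (^-distribʳ-* (n ∸ d) (n C d) m))

    T≢0 : NonZero T
    T≢0 = m^n≢0 (n C d) m {{>-nonZero (nCk>0 n d d≤n)}}

    -- The hypothesis is K + 1 ≤ x = M / T, and `M*M*∑-conn` with one M cancelled gives ℙ(connected)
    -- ≤ T / M.
    connected-bound : ∀ K → suc K * n ^ m ≤ n * (n ∸ d) ^ m → suc K * ∑ Ω conn ≤ T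
    connected-bound K large = *-cancelʳ-≤ _ _ T {{T≢0}} (begin
      suc K * ∑ Ω conn * T    ≡⟨ shuffle (suc K) (∑ Ω conn) T ⟩
      suc K * T * ∑ Ω conn    ≤⟨ *-monoˡ-≤ (∑ Ω conn) KT≤M ⟩
      M * ∑ Ω conn
        ≤⟨ *-cancelˡ-≤ M {{M≢0}} (≤-trans (≤-reflexive (sym (*-assoc M M (∑ Ω conn)))) (≤-trans M*M*∑-conn (≤-reflexive (*-comm (T * T) M)))) ⟩
      T * T                   ∎)
      where
      open ≤-Reasoning
      shuffle : ∀ a b c → a * b * c ≡ a * c * b
      shuffle = solve-∀
      KT≤M : suc K * T ≤ M
      KT≤M = *-cancelˡ-≤ (n ^ m) {{m^n≢0 n m {{>-nonZero (<-≤-trans z<s 2≤n)}}}} (begin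
        n ^ m * (suc K * T)           ≡⟨ shuffle′ (n ^ m) (suc K) T ⟩
        suc K * n ^ m * T             ≤⟨ *-monoˡ-≤ T large ⟩
        n * (n ∸ d) ^ m * T           ≡⟨ *-assoc n ((n ∸ d) ^ m) T ⟩
        n * ((n ∸ d) ^ m * T)         ≡⟨ cong (n *_) n^m*B₁ ⟨
        n * (n ^ m * B₁)              ≡⟨ shuffle″ n (n ^ m) B₁ ⟩
        n ^ m * M                     ∎)
        where
        shuffle′ : ∀ a b c → a * (b * c) ≡ b * a * c
        shuffle′ = solve-∀
        shuffle″ : ∀ a b c → a * (b * c) ≡ b * (a * c)
        shuffle″ = solve-∀
      M≢0 : NonZero M
      M≢0 = >-nonZero (<-≤-trans (>-nonZero⁻¹ (suc K * T) {{m*n≢0 (suc K) T {{_}} {{T≢0}}}}) KT≤M)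

-- From counts to limits of probabilities

open import Data.Integer.Base using (+_; -[1+_])
open import Data.Nat.Base as ℕ using (ℕ; zero; suc; NonZero; _≤_)
import Data.Nat.Properties as ℕ
open import Data.Rational.Base as ℚ using (ℚ; 0ℚ; 1ℚ; mkℚ; _+_; _*_; _-_; -_; _/_; ∣_∣; _<_)
import Data.Rational.Properties as ℚ
open +-*-Solver using (solve; _:+_; _:*_; _:-_; :-_; con; _:=_)
open RationalInequalities
open Logarithms
open Binomials using (nCk>0)
open Counting
open Disconnected
open IsolatedNodes

-- A positive ε times its denominator is its numerator, hence at least 1; one further ε makes the
-- inequality strict.
archimedean : ∀ ε → 0ℚ < ε → ∃[ K ] 1ℚ < fromℕ (suc K) * ε
archimedean ε 0<ε = ℚ.↧ₙ ε , (begin-strict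
  1ℚ                                ≡⟨ ℚ.+-identityˡ 1ℚ ⟨
  0ℚ + 1ℚ                           <⟨ ℚ.+-mono-<-≤ 0<ε (1≤ε*↧ε ε (ℚ.positive 0<ε)) ⟩
  ε + ε * fromℕ (ℚ.↧ₙ ε)
    ≡⟨ solve 2 (λ e k → e :+ e :* k := (con 1ℚ :+ k) :* e) refl ε (fromℕ (ℚ.↧ₙ ε)) ⟩
  (1ℚ + fromℕ (ℚ.↧ₙ ε)) * ε         ≡⟨ cong (_* ε) (fromℕ-suc (ℚ.↧ₙ ε)) ⟨
  fromℕ (suc (ℚ.↧ₙ ε)) * ε          ∎)
  where
  open ℚ.≤-Reasoning
  1≤ε*↧ε : ∀ ε → ℚ.Positive ε → 1ℚ ℚ.≤ ε * fromℕ (ℚ.↧ₙ ε)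
  1≤ε*↧ε ε@(mkℚ (+ suc p) d _) _ = subst (1ℚ ℚ.≤_)
    (trans (sym ([a/k]*k≡a (suc p) (suc d))) (cong (_* fromℕ (suc d)) (ℚ.↥p/↧p≡p ε)))
    (fromℕ-mono-≤ {1} {suc p} (ℕ.s≤s ℕ.z≤n))
  1≤ε*↧ε (mkℚ (+ zero) d _)   record { pos = () }
  1≤ε*↧ε (mkℚ -[1+ _ ] d _)   record { pos = () }

ratio-small : ∀ {x ε} c t K .{{_ : NonZero t}} → x * fromℕ t ≡ fromℕ c → suc K ℕ.* c ≤ t →
  1ℚ < fromℕ (suc K) * ε → ∣ x ∣ < ε
ratio-small {x} {ε} c t K x*t≡c Kc≤t 1<Kε = subst (_< ε) (sym (ℚ.0≤p⇒∣p∣≡p 0≤x))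
  (ℚ.*-cancelˡ-<-nonNeg (fromℕ (suc K)) {{ℚ.nonNegative (0≤fromℕ (suc K))}} (ℚ.≤-<-trans Kx≤1 1<Kε))
  where
  open ℚ.≤-Reasoning
  0≤x : 0ℚ ℚ.≤ x
  0≤x = ℚ.*-cancelʳ-≤-pos (fromℕ t) {{fromℕ-pos t}}
    (subst₂ ℚ._≤_ (sym (ℚ.*-zeroˡ (fromℕ t))) (sym x*t≡c) (0≤fromℕ c))
  Kx≤1 : fromℕ (suc K) * x ℚ.≤ 1ℚ
  Kx≤1 = ℚ.*-cancelʳ-≤-pos (fromℕ t) {{fromℕ-pos t}} (begin
    fromℕ (suc K) * x * fromℕ t     ≡⟨ ℚ.*-assoc (fromℕ (suc K)) x (fromℕ t) ⟩
    fromℕ (suc K) * (x * fromℕ t)   ≡⟨ cong (fromℕ (suc K) *_) x*t≡c ⟩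
    fromℕ (suc K) * fromℕ c         ≡⟨ fromℕ-* (suc K) c ⟨
    fromℕ (suc K ℕ.* c)             ≤⟨ fromℕ-mono-≤ Kc≤t ⟩
    fromℕ t                         ≡⟨ ℚ.*-identityˡ (fromℕ t) ⟨
    1ℚ * fromℕ t                    ∎)

module _ {A : Set} {P : Pred A 0ℓ} (Ω : List A) (P? : Decidable P) where

  ℙ*length : ℙ Ω P? * fromℕ (length Ω) ≡ fromℕ (∑ Ω (λ ω → 𝟙 (P? ω)))
  ℙ*length = trans (count Ω) (cong fromℕ (length-filter≡∑ P? Ω))
    where
    count : ∀ Ω → ℙ Ω P? * fromℕ (length Ω) ≡ fromℕ (length (filter P? Ω))
    -- The default value 0 of `ℙ` on the empty space agrees with the empty count.
    count []         = refl
    count Ω@(_ ∷ _) = [a/k]*k≡a (length (filter P? Ω)) (length Ω)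

  [1-ℙ]*length : (1ℚ - ℙ Ω P?) * fromℕ (length Ω) ≡ fromℕ (∑ Ω (λ ω → 𝟙 (¬? (P? ω))))
  [1-ℙ]*length = begin
    (1ℚ - ℙ Ω P?) * fromℕ (length Ω)
      ≡⟨ solve 2 (λ x t → (con 1ℚ :- x) :* t := t :- x :* t) refl (ℙ Ω P?) (fromℕ (length Ω)) ⟩
    fromℕ (length Ω) - ℙ Ω P? * fromℕ (length Ω)
      ≡⟨ cong₂ _-_ (trans (cong fromℕ (sym total)) (fromℕ-+ c c′)) ℙ*length ⟩
    fromℕ c + fromℕ c′ - fromℕ c
      ≡⟨ solve 2 (λ x y → x :+ y :- x := y) refl (fromℕ c) (fromℕ c′) ⟩
    fromℕ c′                                         ∎
    where
    open ≡-Reasoning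
    c  = ∑ Ω (λ ω → 𝟙 (P? ω))
    c′ = ∑ Ω (λ ω → 𝟙 (¬? (P? ω)))
    total : c ℕ.+ c′ ≡ length Ω
    total = trans (sym (∑-+ Ω _ _)) (trans (∑-cong Ω (λ ω → 𝟙-¬ (P? ω))) (trans (∑-const Ω 1) (ℕ.*-identityʳ _)))

  module _ {ε : ℚ} (K : ℕ) {{_ : NonZero (length Ω)}} (1<Kε : 1ℚ < fromℕ (suc K) * ε) where

    ℙ-near-0 : suc K ℕ.* ∑ Ω (λ ω → 𝟙 (P? ω)) ≤ length Ω → ∣ ℙ Ω P? - 0ℚ ∣ < ε
    ℙ-near-0 rare = subst (λ x → ∣ x ∣ < ε) (sym (ℚ.+-identityʳ (ℙ Ω P?)))
      (ratio-small _ (length Ω) K ℙ*length rare 1<Kε)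

    ℙ-near-1 : suc K ℕ.* ∑ Ω (λ ω → 𝟙 (¬? (P? ω))) ≤ length Ω → ∣ ℙ Ω P? - 1ℚ ∣ < ε
    ℙ-near-1 rare = subst (_< ε)
      (trans (sym (ℚ.∣-p∣≡∣p∣ (1ℚ - ℙ Ω P?))) (cong ∣_∣ (solve 1 (λ x → :- (con 1ℚ :- x) := x :- con 1ℚ) refl (ℙ Ω P?))))
      (ratio-small _ (length Ω) K [1-ℙ]*length rare 1<Kε)

sampleSpace-nonZero : ∀ n m d → d ≤ n → NonZero (length (tuples m (subsetsOfSize n d)))
sampleSpace-nonZero n m d d≤n = subst NonZero (sym (length-sampleSpace n m d))
  (ℕ.m^n≢0 (n C d) m {{ℕ.>-nonZero (nCk>0 n d d≤n)}})

ℙ-connected⟶0 : (m d : ℕ → ℕ) → (∀ n → 2 ≤ n → d n ≤ n) →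
  (λ n → log (fromℕ n) +ᶜ m n ·ᶜ log (1ℚ - + d n / n)) ⟶+∞ →
  (λ n → ℙ-connected n (m n) (d n)) ⟶ 0ℚ
-- The threshold is at least 2 because d n is constrained only from n = 2 on.
ℙ-connected⟶0 m d d≤ diverges ε 0<ε = N ℕ.⊔ 2 , near
  where
  K    = proj₁ (archimedean ε 0<ε)
  1<Kε = proj₂ (archimedean ε 0<ε)
  N    = proj₁ (diverges (fromℕ K))
  far  = proj₂ (diverges (fromℕ K))
  near : ∀ n → .{{_ : NonZero n}} → N ℕ.⊔ 2 ≤ n → ∣ ℙ-connected n (m n) (d n) - 0ℚ ∣ < ε
  near n N⊔2≤n = ℙ-near-0 Ω (λ Vs → connected? (H* Vs)) K {{sampleSpace-nonZero n (m n) (d n) d≤n}} 1<Kε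
    (ℕ.≤-trans
      (SecondMoment.connected-bound n (m n) (d n) 2≤n d≤n K
        (lower⇒large n (m n) (d n) K d≤n (far n (ℕ.m⊔n≤o⇒m≤o N 2 N⊔2≤n))))
      (ℕ.≤-reflexive (sym (length-sampleSpace n (m n) (d n)))))
    where
    Ω = tuples (m n) (subsetsOfSize n (d n))
    2≤n = ℕ.m⊔n≤o⇒n≤o N 2 N⊔2≤n
    d≤n = d≤ n 2≤n

ℙ-connected⟶1 : (m d : ℕ → ℕ) → (∀ n → 2 ≤ n → 2 ≤ d n × d n ≤ n) →
  (λ n → log (fromℕ n) +ᶜ m n ·ᶜ log (1ℚ - + d n / n)) ⟶-∞ →
  (λ n → ℙ-connected n (m n) (d n)) ⟶ 1ℚ
ℙ-connected⟶1 m d ≤d≤ diverges ε 0<ε = N ℕ.⊔ 2 , near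
  where
  K    = proj₁ (archimedean ε 0<ε)
  1<Kε = proj₂ (archimedean ε 0<ε)
  -- This is the constant of `disconnected-bound` for z = K + 1, which yields ℙ(disconnected) ≤ 1/(K
  -- + 1) < ε.
  H    = 4 ℕ.* suc (suc K) ℕ.* (4 ℕ.* suc (suc K))
  N    = proj₁ (diverges (- fromℕ H))
  far  = proj₂ (diverges (- fromℕ H))
  near : ∀ n → .{{_ : NonZero n}} → N ℕ.⊔ 2 ≤ n → ∣ ℙ-connected n (m n) (d n) - 1ℚ ∣ < ε
  near n N⊔2≤n = ℙ-near-1 Ω (λ Vs → connected? (H* Vs)) K {{sampleSpace-nonZero n (m n) (d n) d≤n}} 1<Kε
    (ℕ.≤-trans
      (disconnected-bound (suc K) n (m n) (d n) 2≤d d≤n (begin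
        H ℕ.* n ℕ.* (n ℕ.∸ d n) ℕ.^ m n        ≡⟨ ℕ.*-assoc H n _ ⟩
        H ℕ.* (n ℕ.* (n ℕ.∸ d n) ℕ.^ m n)      ≤⟨ ℕ.*-monoˡ-≤ (n ℕ.* (n ℕ.∸ d n) ℕ.^ m n) (ℕ.n≤1+n H) ⟩
        suc H ℕ.* (n ℕ.* (n ℕ.∸ d n) ℕ.^ m n)
          ≤⟨ upper⇒small n (m n) (d n) H d≤n (far n (ℕ.m⊔n≤o⇒m≤o N 2 N⊔2≤n)) ⟩
        n ℕ.^ m n                              ∎))
      (ℕ.≤-reflexive (sym (length-sampleSpace n (m n) (d n)))))
    where
    open ℕ.≤-Reasoning
    Ω = tuples (m n) (subsetsOfSize n (d n))
    2≤n = ℕ.m⊔n≤o⇒n≤o N 2 N⊔2≤n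
    2≤d = proj₁ (≤d≤ n 2≤n)
    d≤n = proj₂ (≤d≤ n 2≤n)

mainTheorem6 : (m d : ℕ → ℕ) →
    (∀ n → 2 ≤ n → 1 ≤ m n) →
    (∀ n → 2 ≤ n → 2 ≤ d n × d n ≤ n) →
    ((λ n → log (fromℕ n) +ᶜ m n ·ᶜ log (1ℚ - + d n / n)) ⟶+∞ →
    (λ n → ℙ-connected n (m n) (d n)) ⟶ 0ℚ) ×
    ((λ n → log (fromℕ n) +ᶜ m n ·ᶜ log (1ℚ - + d n / n)) ⟶-∞ →
    (λ n → ℙ-connected n (m n) (d n)) ⟶ 1ℚ)
mainTheorem6 m d 1≤m ≤d≤ =
  ℙ-connected⟶0 m d (λ n 2≤n → proj₂ (≤d≤ n 2≤n)) , ℙ-connected⟶1 m d ≤d≤
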